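{- For every $n\geq 2$ and every $m\geq 0$, the initial segment of size $m$ of the balanced order on $X_n$ minimises $\mathrm{gap}(A)$ among all weak antichains $A\subseteq\mathbb{Z}^n$ with $|A|=m$. In particular, for every positive integer $N$, the set $$A_N=\{x\in \mathbb{Z}_{\geq 0}^n: 0\leq x_i\leq N-1\text{ for all } i,\text{ and } x_j=0 \text{ for some } j\}$$ minimises $\mathrm{gap}(A)$ among weak antichains $A\subseteq\mathbb{Z}^n$ of size $|A_N|=N^n-(N-1)^n$.
   Context: A subset $A\subseteq\mathbb{Z}^n$ is a weak antichain if it contains no two elements $x,y$ with $x_i<y_i$ for all $i$. For $1\le i\le n$, $\pi_i:\mathbb{Z}^n\to\mathbb{Z}^{n-1}$ is the projection deleting the $i$-th coordinate. For finite $A$, $\mathrm{gap}(A)=\sum_{i=1}^n|\pi_i(A)|-|A|$. Let $X_n=\{x\in\mathbb{Z}_{\ge0}^n: x_i=0\text{ for some } i\}$ (every subset of $X_n$ is a weak antichain). The balanced order on $X_n$: for distinct $x,y\in X_n$ let $T=\{i: x_i\neq y_i\}$, $M_x=\max_{i\in T}x_i$, $M_y=\max_{i\in T}y_i$; declare $x<y$ if $M_x<M_y$, or if $M_x=M_y$ and $\max\{i\in T: x_i=M_x\}<\max\{i\in T: y_i=M_y\}$. This is a total order on $X_n$; an initial segment of size $m$ is the set of its $m$ smallest elements. -}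

module Defs where

open import Data.Nat as ℕ using (ℕ; zero; suc)
open import Data.Integer as ℤ using (ℤ; +_; -[1+_]; _⊔_; _-_)
open import Data.Fin using (Fin; zero; suc; toℕ)
open import Data.Vec using (Vec; []; _∷_; lookup)
open import Data.Vec.Relation.Unary.All as VAll using ()
open import Data.Vec.Relation.Unary.Any as VAny using ()
open import Data.Vec.Properties using (≡-dec)
open import Data.List using (List; []; _∷_; map; filter; length; deduplicate; allFin; foldr)
open import Data.Nat.ListAction using (sum)
open import Data.List.Membership.Propositional using (_∈_)
open import Data.List.Relation.Unary.Unique.Propositional using (Unique)
open import Data.Product using (_×_)
open import Data.Sum using (_⊎_)
open import Relation.Nullary using (¬_; ¬?)
open import Relation.Binary.PropositionalEquality using (_≡_)

Pt : ℕ → Set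
Pt n = Vec ℤ n

_≟ᵥ_ : ∀ {n} (x y : Pt n) → Relation.Nullary.Dec (x ≡ y)
_≟ᵥ_ = ≡-dec ℤ._≟_

proj : ∀ {n} {A : Set} → Fin n → Vec A n → Vec A (ℕ.pred n)
proj zero (x ∷ xs) = xs
proj {suc (suc m)} (suc i) (x ∷ xs) = x ∷ proj i xs

-- Finite sets are duplicate-free lists; |A| = number of distinct elements
card : ∀ {k} → List (Pt k) → ℕ
card A = length (deduplicate _≟ᵥ_ A)

gap : ∀ {n} → List (Pt n) → ℤ
gap {n} A = + sum (map (λ i → card (map (proj i) A)) (allFin n)) - + card A

WeakAntichain : ∀ {n} → List (Pt n) → Set
WeakAntichain {n} A = ∀ x y → x ∈ A → y ∈ A → ¬ (∀ (i : Fin n) → lookup x i ℤ.< lookup y i)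

InX : ∀ {n} → Pt n → Set
InX x = VAll.All (λ a → + 0 ℤ.≤ a) x × VAny.Any (λ a → a ≡ + 0) x

diffIdx : ∀ {n} → Pt n → Pt n → List (Fin n)
diffIdx {n} x y = filter (λ i → ¬? (lookup x i ℤ.≟ lookup y i)) (allFin n)

-- maximum of a list of integers (only used on nonempty lists of nonnegative
-- integers, where the base value -1 is irrelevant)
maxℤ : List ℤ → ℤ
maxℤ = foldr _⊔_ (-[1+ 0 ])

-- maximum of a list of naturals (only used on nonempty lists)
maxℕ : List ℕ → ℕ
maxℕ = foldr ℕ._⊔_ 0

Mof : ∀ {n} → Pt n → Pt n → ℤ
Mof x y = maxℤ (map (lookup x) (diffIdx x y))

Iof : ∀ {n} → Pt n → Pt n → ℕ
Iof x y = maxℕ (map toℕ (filter (λ i → lookup x i ℤ.≟ Mof x y) (diffIdx x y)))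

_<B_ : ∀ {n} → Pt n → Pt n → Set
x <B y = (Mof x y ℤ.< Mof y x) ⊎ ((Mof x y ≡ Mof y x) × (Iof x y ℕ.< Iof y x))

IsInitialSegment : ∀ {n} → List (Pt n) → ℕ → Set
IsInitialSegment {n} S m =
  Unique S × length S ≡ m × (∀ x → x ∈ S → InX x) ×
  (∀ x y → x ∈ S → InX y → y <B x → y ∈ S)

InAN : ∀ {n} → ℕ → Pt n → Set
InAN N x = VAll.All (λ a → (+ 0 ℤ.≤ a) × (a ℤ.< + N)) x × VAny.Any (λ a → a ≡ + 0) x

{-# OPTIONS --safe #-}
module Submission where

-- Write s(A) = Σ |π_i(A)|.  After translating A into a box of ℕⁿ, induct on n,
-- proving two statements side by side: initial segments of the balanced order
-- minimise s among all subsets of ℕⁿ, and initial segments of X_n minimise s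
-- among weak antichains of the same size.
--
-- Fix a direction i and let A′ be A without the bottom points of its lines in
-- direction i.  Each slice of A′ is a weak antichain in dimension n − 1, there
-- are |π_i(A)| bottom points, and s(A) ≥ |π_i(A)| + s(π_i(A)) + Σ s(slice of A′).
-- So the slices of A′ may be replaced by initial segments of X_{n−1}, at
-- positive heights, and π_i(A) by an initial segment of ℕⁿ⁻¹ at height 0; the
-- latter is enlarged until it contains the others, and surplus points are then
-- removed from the top, each of which lowers s by at least 1.
--
-- Repeating this in all directions terminates because the total code of the
-- set decreases.  If the result is not an initial segment, let x be the least
-- missing point and y the greatest point present, with x < y decided at
-- coordinate j.  Then x and y share no coordinate and yᵢ < xᵢ for all i ≠ j,
-- which leaves enough room to exchange y (or a line through y) for x (or a
-- line through x) without increasing s.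

open import Defs
import Algebra.Properties.CommutativeMonoid.Sum
open import Data.Bool using (Bool; true; false; _∧_; _∨_; not)
open import Data.Bool.Properties using (∧-assoc; ∧-zeroʳ; ∧-identityʳ) renaming (_≟_ to _≟ᵇ_)
open import Data.Empty using (⊥; ⊥-elim)
open import Data.Fin as F using (Fin; zero; suc; toℕ; punchIn; punchOut)
open import Data.Fin.Properties as FP using (any?)
open import Data.Nat as ℕ using (ℕ; zero; suc; _+_; _*_; _∸_; _^_; _⊔_; _≤_; _<_; z≤n; s≤s)
open import Data.Nat.Induction using (<-wellFounded)
open import Data.Nat.Properties
open import Data.Nat.Tactic.RingSolver using (solve-∀)
open import Data.Product using (∃; _×_; _,_; proj₁; proj₂)
open import Data.Sum using (_⊎_; inj₁; inj₂) renaming (map to ⊎-map; swap to ⊎-swap)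
open import Data.Vec using (Vec; []; _∷_; lookup; insertAt; removeAt) renaming (map to vmap)
open import Data.Vec.Properties using (insertAt-lookup; insertAt-punchIn; removeAt-insertAt; insertAt-removeAt)
open import Function using (_∘_)
open import Induction.WellFounded using (Acc; acc)
open import Relation.Binary.Definitions using (tri<; tri≈; tri>)
open import Relation.Binary.PropositionalEquality using (_≡_; _≢_; refl; sym; trans; cong; cong₂; subst; subst₂; module ≡-Reasoning)
open import Relation.Nullary using (Dec; yes; no; ¬_; does)
open import Relation.Nullary.Decidable using (map′; dec-true; _×-dec_; ¬?)

open Algebra.Properties.CommutativeMonoid.Sum +-0-commutativeMonoid
  using (sum; sum-remove; ∑-distrib-+; ∑-comm; sum-cong-≗; sum-replicate-zero)

-- Sums and finite sets

-- Competing sets have equal size, so minimising gap is minimising s. Inside one compression,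
-- however, the quantity carried along is s minus the size: enlarging the slice at height 0 raises
-- the projection along i and the size by the same amount, and removing a surplus point lowers s by
-- at least as much as the size. The statement about all of ℕⁿ is forced by that slice. The
-- projection of a weak antichain can be an arbitrary set, whereas the positive slices inherit the
-- antichain property because each of their points has another point of A below it on its line. An
-- initial segment of X_{n-1} is made comparable with one of ℕⁿ⁻¹ by closing it downwards in the
-- larger order, which does not raise s. The exchange needs two different coordinates, so dimensions
-- 0 and 1 are settled separately. Everything happens in a box with r + 1 values per coordinate; the
-- moves never leave it, which keeps all sums and searches finite.

⟦_⟧ : Bool → ℕ
⟦ true ⟧  = 1
⟦ false ⟧ = 0

true≢false : ∀ {b} → b ≡ true → b ≢ false
true≢false refl ()

¬true⇒false : ∀ {b} → b ≢ true → b ≡ false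
¬true⇒false {true}  p = ⊥-elim (p refl)
¬true⇒false {false} p = refl

¬false⇒true : ∀ {b} → b ≢ false → b ≡ true
¬false⇒true {true}  p = refl
¬false⇒true {false} p = ⊥-elim (p refl)

⟦⟧-mono : ∀ {a b} → (a ≡ true → b ≡ true) → ⟦ a ⟧ ≤ ⟦ b ⟧
⟦⟧-mono {true}  a⇒b rewrite a⇒b refl = ≤-refl
⟦⟧-mono {false} a⇒b = z≤n

⇔⇒≡ : ∀ {a b} → (a ≡ true → b ≡ true) → (b ≡ true → a ≡ true) → a ≡ b
⇔⇒≡ {true}  {true}  _ _ = refl
⇔⇒≡ {true}  {false} f _ = sym (f refl)
⇔⇒≡ {false} {true}  _ g = g refl
⇔⇒≡ {false} {false} _ _ = refl

∧-true : ∀ {a b} → a ∧ b ≡ true → a ≡ true × b ≡ true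
∧-true {true} {true} _ = refl , refl

∨-true : ∀ {a b} → a ∨ b ≡ true → a ≡ true ⊎ b ≡ true
∨-true {true}  _ = inj₁ refl
∨-true {false} p = inj₂ p

∨-introʳ : ∀ a {b} → b ≡ true → a ∨ b ≡ true
∨-introʳ true  _ = refl
∨-introʳ false p = p

not-true : ∀ {a} → not a ≡ true → a ≡ false
not-true {false} _ = refl

does-true : ∀ {p} {P : Set p} (P? : Dec P) → does P? ≡ true → P
does-true (yes p) _ = p

anyᵇ : ∀ {n} → (Fin n → Bool) → Bool
anyᵇ {zero}  f = false
anyᵇ {suc n} f = f zero ∨ anyᵇ (f ∘ suc)

anyᵇ-intro : ∀ {n} (f : Fin n → Bool) t → f t ≡ true → anyᵇ f ≡ true
anyᵇ-intro f zero    p rewrite p = refl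
anyᵇ-intro f (suc t) p = ∨-introʳ (f zero) (anyᵇ-intro (f ∘ suc) t p)

anyᵇ-elim : ∀ {n} (f : Fin n → Bool) → anyᵇ f ≡ true → ∃ λ t → f t ≡ true
anyᵇ-elim {suc n} f p with ∨-true {f zero} p
... | inj₁ q = zero , q
... | inj₂ q = let t , e = anyᵇ-elim (f ∘ suc) q in suc t , e

anyᵇ-cong : ∀ {n} {f g : Fin n → Bool} → (∀ t → f t ≡ g t) → anyᵇ f ≡ anyᵇ g
anyᵇ-cong {zero}  f≗g = refl
anyᵇ-cong {suc n} f≗g = cong₂ _∨_ (f≗g zero) (anyᵇ-cong (f≗g ∘ suc))

sum-mono-≤ : ∀ {n} {f g : Fin n → ℕ} → (∀ i → f i ≤ g i) → sum f ≤ sum g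
sum-mono-≤ {zero}  f≤g = z≤n
sum-mono-≤ {suc n} f≤g = +-mono-≤ (f≤g zero) (sum-mono-≤ (f≤g ∘ suc))

sum-mono-< : ∀ {n} {f g : Fin n → ℕ} → (∀ i → f i ≤ g i) → ∀ i → f i < g i → sum f < sum g
sum-mono-< f≤g zero    fi<gi = +-mono-<-≤ fi<gi (sum-mono-≤ (f≤g ∘ suc))
sum-mono-< f≤g (suc i) fi<gi = +-mono-≤-< (f≤g zero) (sum-mono-< (f≤g ∘ suc) i fi<gi)

term≤sum : ∀ {n} (f : Fin n → ℕ) i → f i ≤ sum f
term≤sum f zero    = m≤m+n _ _
term≤sum f (suc i) = ≤-trans (term≤sum (f ∘ suc) i) (m≤n+m _ (f zero))

sum-*ʳ : ∀ {n} (f : Fin n → ℕ) k → sum (λ i → f i * k) ≡ sum f * k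
sum-*ʳ {zero}  f k = refl
sum-*ʳ {suc n} f k = trans (cong (f zero * k +_) (sum-*ʳ (f ∘ suc) k)) (sym (*-distribʳ-+ k (f zero) _))

sum-const : ∀ n k → sum {n} (λ _ → k) ≡ n * k
sum-const zero    k = refl
sum-const (suc n) k = cong (k +_) (sum-const n k)

sum-δ : ∀ {n} b (a : Fin n) → sum (λ t → ⟦ b ∧ does (t F.≟ a) ⟧) ≡ ⟦ b ⟧
sum-δ {suc n} b zero = begin
  ⟦ b ∧ true ⟧ + sum {n} (λ _ → ⟦ b ∧ false ⟧)
    ≡⟨ cong₂ (λ x y → ⟦ x ⟧ + sum {n} (λ _ → ⟦ y ⟧)) (∧-identityʳ b) (∧-zeroʳ b) ⟩
  ⟦ b ⟧ + sum {n} (λ _ → 0)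
    ≡⟨ cong (⟦ b ⟧ +_) (sum-replicate-zero n) ⟩
  ⟦ b ⟧ + 0
    ≡⟨ +-identityʳ _ ⟩
  ⟦ b ⟧ ∎
  where open ≡-Reasoning
sum-δ {suc n} b (suc a) = begin
  ⟦ b ∧ false ⟧ + sum (λ t → ⟦ b ∧ does (t F.≟ a) ⟧)
    ≡⟨ cong₂ (λ x y → ⟦ x ⟧ + y) (∧-zeroʳ b) (sum-δ b a) ⟩
  ⟦ b ⟧ ∎
  where open ≡-Reasoning

δ-sum : ∀ {n} (a : Fin n) → sum (λ t → ⟦ does (t F.≟ a) ⟧) ≡ 1
δ-sum = sum-δ true

Point : ℕ → ℕ → Set
Point m n = Vec (Fin m) n

-- Boolean membership over a finite box makes the size a sum of indicators and every search
-- decidable.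
PSet : ℕ → ℕ → Set
PSet m n = Point m n → Bool

module _ {m : ℕ} where

  ∑ₚ : ∀ {n} → (Point m n → ℕ) → ℕ
  ∑ₚ {zero}  f = f []
  ∑ₚ {suc n} f = sum λ t → ∑ₚ λ u → f (t ∷ u)

  ∑ₚ-cong : ∀ {n} {f g : Point m n → ℕ} → (∀ x → f x ≡ g x) → ∑ₚ f ≡ ∑ₚ g
  ∑ₚ-cong {zero}  f≗g = f≗g []
  ∑ₚ-cong {suc n} f≗g = sum-cong-≗ λ t → ∑ₚ-cong λ u → f≗g (t ∷ u)

  ∑ₚ-mono-≤ : ∀ {n} {f g : Point m n → ℕ} → (∀ x → f x ≤ g x) → ∑ₚ f ≤ ∑ₚ g
  ∑ₚ-mono-≤ {zero}  f≤g = f≤g []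
  ∑ₚ-mono-≤ {suc n} f≤g = sum-mono-≤ λ t → ∑ₚ-mono-≤ λ u → f≤g (t ∷ u)

  ∑ₚ-mono-< : ∀ {n} {f g : Point m n → ℕ} → (∀ x → f x ≤ g x) → ∀ x → f x < g x → ∑ₚ f < ∑ₚ g
  ∑ₚ-mono-< f≤g []      fx<gx = fx<gx
  ∑ₚ-mono-< f≤g (t ∷ u) fx<gx =
    sum-mono-< (λ t → ∑ₚ-mono-≤ λ u → f≤g (t ∷ u)) t (∑ₚ-mono-< (λ u → f≤g (t ∷ u)) u fx<gx)

  term≤∑ₚ : ∀ {n} (f : Point m n → ℕ) x → f x ≤ ∑ₚ f
  term≤∑ₚ f []      = ≤-refl
  term≤∑ₚ f (t ∷ u) = ≤-trans (term≤∑ₚ (λ u → f (t ∷ u)) u) (term≤sum (λ t → ∑ₚ λ u → f (t ∷ u)) t)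

  ∑ₚ-+ : ∀ {n} (f g : Point m n → ℕ) → ∑ₚ (λ x → f x + g x) ≡ ∑ₚ f + ∑ₚ g
  ∑ₚ-+ {zero}  f g = refl
  ∑ₚ-+ {suc n} f g = trans (sum-cong-≗ λ t → ∑ₚ-+ (λ u → f (t ∷ u)) (λ u → g (t ∷ u)))
                           (∑-distrib-+ (λ t → ∑ₚ λ u → f (t ∷ u)) (λ t → ∑ₚ λ u → g (t ∷ u)))

  ∑ₚ-*ʳ : ∀ {n} (f : Point m n → ℕ) k → ∑ₚ (λ x → f x * k) ≡ ∑ₚ f * k
  ∑ₚ-*ʳ {zero}  f k = refl
  ∑ₚ-*ʳ {suc n} f k = trans (sum-cong-≗ λ t → ∑ₚ-*ʳ (λ u → f (t ∷ u)) k)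
                            (sum-*ʳ (λ t → ∑ₚ λ u → f (t ∷ u)) k)

  sum-∑ₚ-comm : ∀ {k n} (f : Fin k → Point m n → ℕ) →
                sum (λ i → ∑ₚ (f i)) ≡ ∑ₚ (λ x → sum (λ i → f i x))
  sum-∑ₚ-comm {n = zero}  f = refl
  sum-∑ₚ-comm {n = suc n} f = trans (∑-comm λ i t → ∑ₚ λ u → f i (t ∷ u))
                                    (sum-cong-≗ λ t → sum-∑ₚ-comm λ i u → f i (t ∷ u))

  ∑ₚ-slice : ∀ {n} i (f : Point m (suc n) → ℕ) → ∑ₚ f ≡ sum (λ t → ∑ₚ λ u → f (insertAt u i t))
  ∑ₚ-slice zero f = refl
  ∑ₚ-slice {suc n} (suc i) f =
    trans (sum-cong-≗ λ s → ∑ₚ-slice i (λ u → f (s ∷ u)))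
          (∑-comm λ s t → ∑ₚ λ u → f (s ∷ insertAt u i t))

  eqₚ : ∀ {n} → Point m n → Point m n → Bool
  eqₚ []      []      = true
  eqₚ (s ∷ u) (t ∷ v) = does (s F.≟ t) ∧ eqₚ u v

  eqₚ-refl : ∀ {n} (x : Point m n) → eqₚ x x ≡ true
  eqₚ-refl []      = refl
  eqₚ-refl (t ∷ u) = cong₂ _∧_ (dec-true (t F.≟ t) refl) (eqₚ-refl u)

  eqₚ-sound : ∀ {n} (x y : Point m n) → eqₚ x y ≡ true → x ≡ y
  eqₚ-sound []      []      _ = refl
  eqₚ-sound (s ∷ u) (t ∷ v) p with ∧-true p
  ... | q , r = cong₂ _∷_ (does-true (s F.≟ t) q) (eqₚ-sound u v r)

  ∑ₚ-δ : ∀ {n} b (p : Point m n) → ∑ₚ (λ x → ⟦ b ∧ eqₚ x p ⟧) ≡ ⟦ b ⟧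
  ∑ₚ-δ b []      = cong ⟦_⟧ (∧-identityʳ b)
  ∑ₚ-δ b (a ∷ p) = begin
    sum (λ t → ∑ₚ λ u → ⟦ b ∧ (does (t F.≟ a) ∧ eqₚ u p) ⟧)
      ≡⟨ sum-cong-≗ {m} (λ t → ∑ₚ-cong λ u → cong ⟦_⟧ (sym (∧-assoc b (does (t F.≟ a)) (eqₚ u p)))) ⟩
    sum (λ t → ∑ₚ λ u → ⟦ (b ∧ does (t F.≟ a)) ∧ eqₚ u p ⟧)
      ≡⟨ sum-cong-≗ {m} (λ t → ∑ₚ-δ (b ∧ does (t F.≟ a)) p) ⟩
    sum (λ t → ⟦ b ∧ does (t F.≟ a) ⟧)
      ≡⟨ sum-δ b a ⟩
    ⟦ b ⟧ ∎
    where open ≡-Reasoning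

  anyₚ? : ∀ {n} {P : Point m n → Set} → (∀ x → Dec (P x)) → Dec (∃ P)
  anyₚ? {zero}  P? = map′ ([] ,_) (λ { ([] , p) → p }) (P? [])
  anyₚ? {suc n} P? = map′ (λ { (t , u , p) → t ∷ u , p }) (λ { (t ∷ u , p) → t , u , p })
                          (any? λ t → anyₚ? λ u → P? (t ∷ u))

  argmin : ∀ {n} {P : Point m n → Set} → (∀ x → Dec (P x)) → (f : Point m n → ℕ) →
           (∀ x → ¬ P x) ⊎ (∃ λ x → P x × ∀ y → P y → f x ≤ f y)
  argmin {n} {P} P? f with anyₚ? P?
  ... | no ¬p = inj₁ λ x px → ¬p (x , px)
  ... | yes (x₀ , p₀) = inj₂ (go x₀ p₀ (<-wellFounded (f x₀)))
    where
    go : ∀ x → P x → Acc _<_ (f x) → ∃ λ x → P x × ∀ y → P y → f x ≤ f y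
    go x px (acc rec) with anyₚ? (λ y → P? y ×-dec (f y ℕ.<? f x))
    ... | yes (y , py , fy<fx) = go y py (rec fy<fx)
    ... | no ¬q = x , px , λ y py → ≮⇒≥ λ fy<fx → ¬q (y , py , fy<fx)

  argmax : ∀ {n} {P : Point m n → Set} → (∀ x → Dec (P x)) → (f : Point m n → ℕ) →
           (∀ x → ¬ P x) ⊎ (∃ λ x → P x × ∀ y → P y → f y ≤ f x)
  argmax P? f with argmin P? (λ x → ∑ₚ f ∸ f x)
  ... | inj₁ ¬p = inj₁ ¬p
  ... | inj₂ (x , px , le) = inj₂ (x , px , λ y py → ≮⇒≥ λ fx<fy → <⇒≱ (∸-monoʳ-< fx<fy (term≤∑ₚ f y)) (le y py))

  infix 4 _⊆_
  _⊆_ : ∀ {n} → PSet m n → PSet m n → Set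
  D ⊆ E = ∀ x → D x ≡ true → E x ≡ true

  size : ∀ {n} → PSet m n → ℕ
  size D = ∑ₚ λ x → ⟦ D x ⟧

  size-mono : ∀ {n} {D E : PSet m n} → D ⊆ E → size D ≤ size E
  size-mono D⊆E = ∑ₚ-mono-≤ λ x → ⟦⟧-mono (D⊆E x)

  size-cong : ∀ {n} {D E : PSet m n} → (∀ x → D x ≡ E x) → size D ≡ size E
  size-cong D≗E = ∑ₚ-cong λ x → cong ⟦_⟧ (D≗E x)

  size-empty : ∀ {n} {D : PSet m n} → (∀ x → D x ≡ false) → size D ≡ 0
  size-empty {n} {D} empty = trans (∑ₚ-cong λ x → cong ⟦_⟧ (empty x)) (∑ₚ-zero {n})
    where
    ∑ₚ-zero : ∀ {n} → ∑ₚ {n} (λ _ → 0) ≡ 0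
    ∑ₚ-zero {zero}  = refl
    ∑ₚ-zero {suc n} = trans (sum-cong-≗ {m} λ t → ∑ₚ-zero {n}) (sum-replicate-zero m)

  size-mono-< : ∀ {n} {D E : PSet m n} → D ⊆ E → ∀ x → D x ≡ false → E x ≡ true → size D < size E
  size-mono-< D⊆E x x∉D x∈E =
    ∑ₚ-mono-< (λ x → ⟦⟧-mono (D⊆E x)) x (subst (_< _) (sym (cong ⟦_⟧ x∉D)) (subst (0 <_) (sym (cong ⟦_⟧ x∈E)) ≤-refl))

  ⊆∧≥⇒⊇ : ∀ {n} {D E : PSet m n} → D ⊆ E → size E ≤ size D → E ⊆ D
  ⊆∧≥⇒⊇ {D = D} {E} D⊆E ≥ x x∈E with D x in eq
  ... | true  = refl
  ... | false = ⊥-elim (<⇒≱ (size-mono-< {D = D} {E} D⊆E x eq x∈E) ≥)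

  nonempty? : ∀ {n} (D : PSet m n) → (∃ λ x → D x ≡ true) ⊎ (∀ x → D x ≡ false)
  nonempty? D with anyₚ? (λ x → D x ≟ᵇ true)
  ... | yes p = inj₁ p
  ... | no ¬p = inj₂ λ x → ¬true⇒false λ e → ¬p (x , e)

  slice : ∀ {n} → Fin (suc n) → PSet m (suc n) → Fin m → PSet m n
  slice i D t u = D (insertAt u i t)

  size-slice : ∀ {n} i (D : PSet m (suc n)) → size D ≡ sum (λ t → size (slice i D t))
  size-slice i D = ∑ₚ-slice i (λ x → ⟦ D x ⟧)

  glue : ∀ {n} → Fin (suc n) → (Fin m → PSet m n) → PSet m (suc n)
  glue i W x = W (lookup x i) (removeAt x i)

  slice-glue : ∀ {n} i (W : Fin m → PSet m n) t u → slice i (glue i W) t u ≡ W t u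
  slice-glue i W t u = cong₂ W (insertAt-lookup u i t) (removeAt-insertAt u i t)

  glue-slice : ∀ {n} i (D : PSet m (suc n)) x → slice i D (lookup x i) (removeAt x i) ≡ D x
  glue-slice i D x = cong D (insertAt-removeAt x i)

  shadow : ∀ {n} → Fin (suc n) → PSet m (suc n) → PSet m n
  shadow i D u = anyᵇ λ t → D (insertAt u i t)

  shadow-intro : ∀ {n} i (D : PSet m (suc n)) t u → D (insertAt u i t) ≡ true → shadow i D u ≡ true
  shadow-intro i D t u p = anyᵇ-intro (λ t → D (insertAt u i t)) t p

  shadow-introₚ : ∀ {n} i (D : PSet m (suc n)) x → D x ≡ true → shadow i D (removeAt x i) ≡ true
  shadow-introₚ i D x p = shadow-intro i D (lookup x i) _ (trans (glue-slice i D x) p)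

  shadow-elim : ∀ {n} i (D : PSet m (suc n)) u → shadow i D u ≡ true → ∃ λ t → D (insertAt u i t) ≡ true
  shadow-elim i D u p = anyᵇ-elim (λ t → D (insertAt u i t)) p

  shadow-mono : ∀ {n} i {D E : PSet m (suc n)} → D ⊆ E → shadow i D ⊆ shadow i E
  shadow-mono i {D} {E} D⊆E u p with shadow-elim i D u p
  ... | t , q = shadow-intro i E t u (D⊆E _ q)

  -- The s of the overview, with `shadow i` as π_i; in dimension 0 there is no direction to project
  -- along.
  shadows : ∀ {n} → PSet m n → ℕ
  shadows {zero}  D = 0
  shadows {suc n} D = sum λ i → size (shadow i D)

  shadows-mono-shadow : ∀ {n} {D E : PSet m (suc n)} → (∀ i → shadow i D ⊆ shadow i E) → shadows D ≤ shadows E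
  shadows-mono-shadow {D = D} {E} p = sum-mono-≤ λ i → size-mono {D = shadow i D} {shadow i E} (p i)

  shadows-mono : ∀ {n} {D E : PSet m n} → D ⊆ E → shadows D ≤ shadows E
  shadows-mono {zero}  D⊆E = z≤n
  shadows-mono {suc n} {D} {E} D⊆E = shadows-mono-shadow {D = D} {E} λ i → shadow-mono i {D} {E} D⊆E

-- The balanced order

punchIn-cases : ∀ {n} {P : Fin (suc n) → Set} i → P i → (∀ k → P (punchIn i k)) → ∀ k → P k
punchIn-cases {P = P} i pᵢ p k with i F.≟ k
... | yes refl = pᵢ
... | no i≢k   = subst P (FP.punchIn-punchOut i≢k) (p (punchOut i≢k))

module _ {m : ℕ} where

  lookup-removeAt : ∀ {n} (x : Point m (suc n)) i k → lookup (removeAt x i) k ≡ lookup x (punchIn i k)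
  lookup-removeAt x i k = trans (sym (insertAt-punchIn (removeAt x i) i (lookup x i) k))
                                (cong (λ z → lookup z (punchIn i k)) (insertAt-removeAt x i))

  update : ∀ {n} → Point m (suc n) → Fin (suc n) → Fin m → Point m (suc n)
  update x i a = insertAt (removeAt x i) i a

  lookup-update : ∀ {n} (x : Point m (suc n)) i a → lookup (update x i a) i ≡ a
  lookup-update x i a = insertAt-lookup (removeAt x i) i a

  lookup-update-punchIn : ∀ {n} (x : Point m (suc n)) i a k →
                          lookup (update x i a) (punchIn i k) ≡ lookup x (punchIn i k)
  lookup-update-punchIn x i a k = trans (insertAt-punchIn (removeAt x i) i a k) (lookup-removeAt x i k)

  lookup-update-≢ : ∀ {n} (x : Point m (suc n)) i a {k} → i ≢ k → lookup (update x i a) k ≡ lookup x k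
  lookup-update-≢ x i a {k} i≢k with i F.≟ k
  ... | yes p = ⊥-elim (i≢k p)
  ... | no ¬p = subst (λ k → lookup (update x i a) k ≡ lookup x k) (FP.punchIn-punchOut ¬p)
                      (lookup-update-punchIn x i a (punchOut ¬p))

  lookup-insertAt-≢ : ∀ {n} (u : Point m n) i s t {k} → i ≢ k →
                      lookup (insertAt u i s) k ≡ lookup (insertAt u i t) k
  lookup-insertAt-≢ u i s t {k} i≢k =
    subst (λ k → lookup (insertAt u i s) k ≡ lookup (insertAt u i t) k) (FP.punchIn-punchOut i≢k)
          (trans (insertAt-punchIn u i s _) (sym (insertAt-punchIn u i t _)))

  -- (a , i) ⊑ (b , j): coordinate i carrying value a ranks at most as high as
  -- coordinate j carrying value b.
  infix 4 _⊑_ _≺_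
  _⊑_ : ∀ {n} → Fin m × Fin n → Fin m × Fin n → Set
  (a , i) ⊑ (b , j) = a F.< b ⊎ (a ≡ b × i F.≤ j)

  -- j is the coordinate of T = {i : xᵢ ≠ yᵢ} at which the balanced order
  -- decides x < y.
  Decides : ∀ {n} → Point m n → Point m n → Fin n → Set
  Decides x y j = lookup x j F.< lookup y j ×
    (∀ i → lookup x i ≡ lookup y i ⊎
           ((lookup x i , i) ⊑ (lookup y j , j) × (lookup y i , i) ⊑ (lookup y j , j)))

  record _≺_ {n} (x y : Point m n) : Set where
    constructor _▹_
    field
      decider : Fin n
      decides : Decides x y decider

  ⊑⇒≤ : ∀ {n a b} {i j : Fin n} → (a , i) ⊑ (b , j) → a F.≤ b
  ⊑⇒≤ (inj₁ a<b)        = <⇒≤ a<b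
  ⊑⇒≤ (inj₂ (refl , _)) = ≤-refl

  private
    ≤⇒⊑ : ∀ {n a b} {j : Fin n} → a F.≤ b → (a , zero) ⊑ (b , suc j)
    ≤⇒⊑ a≤b with m≤n⇒m<n∨m≡n a≤b
    ... | inj₁ a<b = inj₁ a<b
    ... | inj₂ a≡b = inj₂ (FP.toℕ-injective a≡b , z≤n)

    suc-⊑ : ∀ {n a b} {i j : Fin n} → (a , i) ⊑ (b , j) → (a , suc i) ⊑ (b , suc j)
    suc-⊑ (inj₁ a<b)         = inj₁ a<b
    suc-⊑ (inj₂ (a≡b , i≤j)) = inj₂ (a≡b , s≤s i≤j)

    decides-∷ : ∀ {n s t j} {u v : Point m n} → s ≡ t ⊎ (s F.≤ lookup v j × t F.≤ lookup v j) →
                Decides u v j → Decides (s ∷ u) (t ∷ v) (suc j)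
    decides-∷ {s = s} {t} {j} {u} {v} h (uⱼ<vⱼ , d) = uⱼ<vⱼ , λ { zero → head h ; (suc i) → tail (d i) }
      where
      head : s ≡ t ⊎ (s F.≤ lookup v j × t F.≤ lookup v j) →
             s ≡ t ⊎ ((s , zero) ⊑ (lookup v j , suc j) × (t , zero) ⊑ (lookup v j , suc j))
      head (inj₁ s≡t)       = inj₁ s≡t
      head (inj₂ (p , q))   = inj₂ (≤⇒⊑ p , ≤⇒⊑ q)
      tail : ∀ {i} → lookup u i ≡ lookup v i ⊎ ((lookup u i , i) ⊑ (lookup v j , j) × (lookup v i , i) ⊑ (lookup v j , j)) →
             lookup u i ≡ lookup v i ⊎ ((lookup u i , suc i) ⊑ (lookup v j , suc j) × (lookup v i , suc i) ⊑ (lookup v j , suc j))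
      tail (inj₁ e)       = inj₁ e
      tail (inj₂ (p , q)) = inj₂ (suc-⊑ p , suc-⊑ q)

    decides-head : ∀ {n s t} {u v : Point m n} → s F.< t →
                   (∀ i → lookup u i ≡ lookup v i ⊎ (lookup u i F.< t × lookup v i F.< t)) → s ∷ u ≺ t ∷ v
    decides-head {s = s} {t} {u} {v} s<t h =
      zero ▹ (s<t , λ { zero → inj₂ (inj₁ s<t , inj₂ (refl , z≤n)) ; (suc i) → tail (h i) })
      where
      tail : ∀ {i} → lookup u i ≡ lookup v i ⊎ (lookup u i F.< t × lookup v i F.< t) →
             lookup u i ≡ lookup v i ⊎ ((lookup u i , suc i) ⊑ (t , zero) × (lookup v i , suc i) ⊑ (t , zero))
      tail (inj₁ e)       = inj₁ e
      tail (inj₂ (p , q)) = inj₂ (inj₁ p , inj₁ q)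

    -- The old decider stays in charge unless the heads differ and the larger one strictly exceeds
    -- the value there; a tie goes to the old decider, whose index is larger. In the remaining case
    -- the head decides.
    ≺-∷ : ∀ {n} s t {u v : Point m n} → u ≺ v → s ∷ u ≺ t ∷ v ⊎ t ∷ v ≺ s ∷ u
    ≺-∷ s t {u} {v} (j ▹ d) with FP.<-cmp s t
    ... | tri≈ _ s≡t _ = inj₁ (suc j ▹ decides-∷ (inj₁ s≡t) d)
    ... | tri< s<t _ _ with t F.≤? lookup v j
    ...   | yes t≤ = inj₁ (suc j ▹ decides-∷ (inj₂ (≤-trans (<⇒≤ s<t) t≤ , t≤)) d)
    ...   | no  t≰ = inj₁ (decides-head s<t λ i → below (proj₂ d i))
      where
      below : ∀ {i} → lookup u i ≡ lookup v i ⊎ ((lookup u i , i) ⊑ (lookup v j , j) × (lookup v i , i) ⊑ (lookup v j , j)) →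
              lookup u i ≡ lookup v i ⊎ (lookup u i F.< t × lookup v i F.< t)
      below (inj₁ e)       = inj₁ e
      below (inj₂ (p , q)) = inj₂ (≤-<-trans (⊑⇒≤ p) (≰⇒> t≰) , ≤-<-trans (⊑⇒≤ q) (≰⇒> t≰))
    ≺-∷ s t {u} {v} (j ▹ d) | tri> _ _ t<s with s F.≤? lookup v j
    ...   | yes s≤ = inj₁ (suc j ▹ decides-∷ (inj₂ (s≤ , ≤-trans (<⇒≤ t<s) s≤)) d)
    ...   | no  s≰ = inj₂ (decides-head t<s λ i → below (proj₂ d i))
      where
      below : ∀ {i} → lookup u i ≡ lookup v i ⊎ ((lookup u i , i) ⊑ (lookup v j , j) × (lookup v i , i) ⊑ (lookup v j , j)) →
              lookup v i ≡ lookup u i ⊎ (lookup v i F.< s × lookup u i F.< s)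
      below (inj₁ e)       = inj₁ (sym e)
      below (inj₂ (p , q)) = inj₂ (≤-<-trans (⊑⇒≤ q) (≰⇒> s≰) , ≤-<-trans (⊑⇒≤ p) (≰⇒> s≰))

  ≺-total : ∀ {n} (x y : Point m n) → x ≡ y ⊎ (x ≺ y ⊎ y ≺ x)
  ≺-total []      []      = inj₁ refl
  ≺-total (s ∷ u) (t ∷ v) with ≺-total u v
  ... | inj₂ (inj₁ u≺v) = inj₂ (≺-∷ s t u≺v)
  ... | inj₂ (inj₂ v≺u) = inj₂ (⊎-swap (≺-∷ t s v≺u))
  ... | inj₁ refl with FP.<-cmp s t
  ...   | tri≈ _ refl _ = inj₁ refl
  ...   | tri< s<t _ _  = inj₂ (inj₁ (decides-head s<t λ _ → inj₁ refl))
  ...   | tri> _ _ t<s  = inj₂ (inj₂ (decides-head t<s λ _ → inj₁ refl))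

  -- The pairs (value, coordinate), listed in increasing rank, are numbered by
  -- exponents; a base exceeding the number of coordinates makes the code
  -- strictly increasing along ≺.
  exponent : ∀ n → Fin m → Fin n → ℕ
  exponent n a i = n * toℕ a + toℕ i

  code : ∀ {n} → Point m n → ℕ
  code {n} x = sum λ i → suc n ^ exponent n (lookup x i) i

  private
    exponent-< : ∀ {n a b} {i j : Fin n} → a F.< b → exponent n a i < exponent n b j
    exponent-< {n} {a} {b} {i} {j} a<b = begin-strict
      n * toℕ a + toℕ i  <⟨ +-monoʳ-< (n * toℕ a) (FP.toℕ<n i) ⟩
      n * toℕ a + n      ≡⟨ +-comm (n * toℕ a) n ⟩
      n + n * toℕ a      ≡⟨ sym (*-suc n (toℕ a)) ⟩
      n * suc (toℕ a)    ≤⟨ *-monoʳ-≤ n a<b ⟩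
      n * toℕ b          ≤⟨ m≤m+n _ (toℕ j) ⟩
      n * toℕ b + toℕ j  ∎
      where open ≤-Reasoning

    exponent-⊑ : ∀ {n a b} {i j : Fin n} → i ≢ j → (a , i) ⊑ (b , j) → exponent n a i < exponent n b j
    exponent-⊑ {a = a} {b} {i} {j} i≢j (inj₁ a<b) = exponent-< {_} {a} {b} {i} {j} a<b
    exponent-⊑ {n} {a} i≢j (inj₂ (refl , i≤j)) =
      +-monoʳ-< (n * toℕ a) (≤∧≢⇒< i≤j (i≢j ∘ FP.toℕ-injective))

  -- Let h be the power one below the deciding term of y. At j, y has (n + 1)h and x at most h; at
  -- any other coordinate the term of x exceeds that of y by at most h. Summing gives code x + (n +
  -- 1)h ≤ code y + nh.
  ≺⇒code< : ∀ {n} {x y : Point m n} → x ≺ y → code x < code y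
  ≺⇒code< {n} {x} {y} (j ▹ (xⱼ<yⱼ , d)) = +-cancelʳ-< (n * h) (code x) (code y) (begin-strict
    code x + n * h                            <⟨ +-monoʳ-< (code x) (m<n+m (n * h) (m^n>0 (suc n) (ℕ.pred top))) ⟩
    code x + (h + n * h)                      ≡⟨ cong (code x +_) (sym (trans (sum-*ʳ (λ i → ⟦ does (i F.≟ j) ⟧) _)
                                                   (trans (cong (_* (h + n * h)) (δ-sum j)) (*-identityˡ _)))) ⟩
    code x + sum (λ i → ⟦ does (i F.≟ j) ⟧ * (h + n * h))
                                              ≡⟨ sym (∑-distrib-+ (λ i → w x i) _) ⟩
    sum (λ i → w x i + ⟦ does (i F.≟ j) ⟧ * (h + n * h))
                                              ≤⟨ sum-mono-≤ termwise ⟩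
    sum (λ i → w y i + h)                     ≡⟨ ∑-distrib-+ (λ i → w y i) _ ⟩
    code y + sum {n} (λ _ → h)                ≡⟨ cong (code y +_) (sum-const n h) ⟩
    code y + n * h                            ∎)
    where
    open ≤-Reasoning
    w : Point m n → Fin n → ℕ
    w x i = suc n ^ exponent n (lookup x i) i
    top : ℕ
    top = exponent n (lookup y j) j
    h : ℕ
    h = suc n ^ ℕ.pred top
    small : ∀ {e} → e < top → suc n ^ e ≤ h
    small e<top = ^-monoʳ-≤ (suc n) (<⇒≤pred e<top)
    suc-h : h + n * h ≡ suc n ^ top
    suc-h = cong (suc n ^_) (suc-pred top ⦃ ℕ.>-nonZero (≤-<-trans z≤n (exponent-< {n} {i = j} {j} xⱼ<yⱼ)) ⦄)
    termwise : ∀ i → w x i + ⟦ does (i F.≟ j) ⟧ * (h + n * h) ≤ w y i + h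
    termwise i with i F.≟ j
    ... | yes refl = begin
      w x i + (h + n * h + 0)  ≡⟨ cong (w x i +_) (trans (+-identityʳ _) suc-h) ⟩
      w x i + w y i            ≤⟨ +-monoˡ-≤ (w y i) (small (exponent-< {n} {i = j} {j} xⱼ<yⱼ)) ⟩
      h + w y i                ≡⟨ +-comm h _ ⟩
      w y i + h                ∎
    ... | no i≢j with d i
    ...   | inj₁ e = begin
      w x i + 0  ≡⟨ trans (+-identityʳ _) (cong (λ a → suc n ^ exponent n a i) e) ⟩
      w y i      ≤⟨ m≤m+n _ h ⟩
      w y i + h  ∎
    ...   | inj₂ (x⊑ , _) = begin
      w x i + 0  ≡⟨ +-identityʳ _ ⟩
      w x i      ≤⟨ small (exponent-⊑ i≢j x⊑) ⟩
      h          ≤⟨ m≤n+m h _ ⟩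
      w y i + h  ∎

  ≺-irrefl : ∀ {n} {x : Point m n} → ¬ x ≺ x
  ≺-irrefl x≺x = <-irrefl refl (≺⇒code< x≺x)

  ≺-asym : ∀ {n} {x y : Point m n} → x ≺ y → ¬ y ≺ x
  ≺-asym x≺y y≺x = <-asym (≺⇒code< x≺y) (≺⇒code< y≺x)

  code<⇒≺ : ∀ {n} {x y : Point m n} → code x < code y → x ≺ y
  code<⇒≺ {x = x} {y} lt with ≺-total x y
  ... | inj₁ refl       = ⊥-elim (<-irrefl refl lt)
  ... | inj₂ (inj₁ x≺y) = x≺y
  ... | inj₂ (inj₂ y≺x) = ⊥-elim (<-asym lt (≺⇒code< y≺x))

  code-injective : ∀ {n} {x y : Point m n} → code x ≡ code y → x ≡ y
  code-injective {x = x} {y} eq with ≺-total x y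
  ... | inj₁ x≡y        = x≡y
  ... | inj₂ (inj₁ x≺y) = ⊥-elim (<-irrefl eq (≺⇒code< x≺y))
  ... | inj₂ (inj₂ y≺x) = ⊥-elim (<-irrefl (sym eq) (≺⇒code< y≺x))

  _≺?_ : ∀ {n} (x y : Point m n) → Dec (x ≺ y)
  x ≺? y = map′ code<⇒≺ ≺⇒code< (code x ℕ.<? code y)

  ≺-insertAt : ∀ {n} {u v : Point m n} i t → u ≺ v → insertAt u i t ≺ insertAt v i t
  ≺-insertAt {n} {u} {v} i t (j ▹ (uⱼ<vⱼ , d)) =
    punchIn i j
    ▹ ((begin-strict
        toℕ (lookup (insertAt u i t) (punchIn i j)) ≡⟨ cong toℕ (insertAt-punchIn u i t j) ⟩
        toℕ (lookup u j)                            <⟨ uⱼ<vⱼ ⟩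
        toℕ (lookup v j)                            ≡⟨ cong toℕ (sym (insertAt-punchIn v i t j)) ⟩
        toℕ (lookup (insertAt v i t) (punchIn i j)) ∎)
    , punchIn-cases i (inj₁ (trans (insertAt-lookup u i t) (sym (insertAt-lookup v i t)))) other)
    where
    open ≤-Reasoning
    punchIn-⊑ : ∀ {k a b a′ b′} → a′ ≡ a → b′ ≡ b → (a , k) ⊑ (b , j) → (a′ , punchIn i k) ⊑ (b′ , punchIn i j)
    punchIn-⊑ refl refl (inj₁ a<b)         = inj₁ a<b
    punchIn-⊑ refl refl (inj₂ (a≡b , k≤j)) = inj₂ (a≡b , FP.punchIn-mono-≤ i _ _ k≤j)
    other : ∀ k → lookup (insertAt u i t) (punchIn i k) ≡ lookup (insertAt v i t) (punchIn i k) ⊎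
                  ((lookup (insertAt u i t) (punchIn i k) , punchIn i k) ⊑ (lookup (insertAt v i t) (punchIn i j) , punchIn i j) ×
                   (lookup (insertAt v i t) (punchIn i k) , punchIn i k) ⊑ (lookup (insertAt v i t) (punchIn i j) , punchIn i j))
    other k with d k
    ... | inj₁ e       = inj₁ (trans (insertAt-punchIn u i t k) (trans e (sym (insertAt-punchIn v i t k))))
    ... | inj₂ (p , q) = inj₂ (punchIn-⊑ (insertAt-punchIn u i t k) (insertAt-punchIn v i t j) p
                              , punchIn-⊑ (insertAt-punchIn v i t k) (insertAt-punchIn v i t j) q)

  ≺-insertAt⁻ : ∀ {n} {u v : Point m n} i t → insertAt u i t ≺ insertAt v i t → u ≺ v
  ≺-insertAt⁻ {u = u} {v} i t lt with ≺-total u v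
  ... | inj₁ refl       = ⊥-elim (≺-irrefl lt)
  ... | inj₂ (inj₁ u≺v) = u≺v
  ... | inj₂ (inj₂ v≺u) = ⊥-elim (≺-asym lt (≺-insertAt i t v≺u))

  insertAt-≺ : ∀ {n} (u : Point m n) i {s t} → s F.< t → insertAt u i s ≺ insertAt u i t
  insertAt-≺ u i {s} {t} s<t =
    i ▹ (lt , punchIn-cases i (inj₂ (inj₁ lt , inj₂ (refl , ≤-refl)))
               λ k → inj₁ (trans (insertAt-punchIn u i s k) (sym (insertAt-punchIn u i t k))))
    where
    lt : lookup (insertAt u i s) i F.< lookup (insertAt u i t) i
    lt rewrite insertAt-lookup u i s | insertAt-lookup u i t = s<t

  update-≺ : ∀ {n} (x : Point m (suc n)) i {a} → a F.< lookup x i → update x i a ≺ x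
  update-≺ x i {a} a<xᵢ = subst (update x i a ≺_) (insertAt-removeAt x i) (insertAt-≺ (removeAt x i) i a<xᵢ)

  ≺-update : ∀ {n} (x : Point m (suc n)) i {a} → lookup x i F.< a → x ≺ update x i a
  ≺-update x i {a} xᵢ<a = subst (_≺ update x i a) (insertAt-removeAt x i) (insertAt-≺ (removeAt x i) i xᵢ<a)

-- Initial segments

finite-choice : ∀ {n} {P Q : Fin n → Set} → (∀ i → P i ⊎ Q i) → (∀ i → P i) ⊎ ∃ Q
finite-choice {zero}  h = inj₁ λ ()
finite-choice {suc n} h with h zero | finite-choice (h ∘ suc)
... | inj₂ q | _            = inj₂ (zero , q)
... | inj₁ p | inj₂ (i , q) = inj₂ (suc i , q)
... | inj₁ p | inj₁ ps      = inj₁ λ { zero → p ; (suc i) → ps i }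

sum-choice : ∀ {n} {P : Fin n → Set} {f g : Fin n → ℕ} → (∀ i → f i ≤ g i) →
             (∀ i → P i ⊎ f i < g i) → (∀ i → P i) ⊎ sum f < sum g
sum-choice f≤g h with finite-choice h
... | inj₁ p       = inj₁ p
... | inj₂ (i , q) = inj₂ (sum-mono-< f≤g i q)

module _ {m : ℕ} where

  -- The ambient set varies: ℕⁿ (`full`), X_n (`hasZero`), their slices, and in `trim` an arbitrary
  -- finite set.
  record IsInit {n} (Ω I : PSet m n) : Set where
    field
      sub    : I ⊆ Ω
      closed : ∀ x y → Ω x ≡ true → x ≺ y → I y ≡ true → I x ≡ true
  open IsInit public

  IsInit-cong : ∀ {n} {Ω Ω′ I J : PSet m n} → (∀ x → Ω x ≡ Ω′ x) → (∀ x → I x ≡ J x) → IsInit Ω I → IsInit Ω′ J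
  IsInit-cong Ω≗ I≗ init .sub x p = trans (sym (Ω≗ x)) (sub init x (trans (I≗ x) p))
  IsInit-cong Ω≗ I≗ init .closed x y p x≺y q =
    trans (sym (I≗ x)) (closed init x y (trans (Ω≗ x) p) x≺y (trans (I≗ y) q))

  init-below : ∀ {n} {Ω I : PSet m n} → IsInit Ω I → ∀ x y → I x ≡ true → Ω y ≡ true → I y ≡ false → x ≺ y
  init-below init x y x∈I y∈Ω y∉I with ≺-total x y
  ... | inj₁ refl       = ⊥-elim (true≢false x∈I y∉I)
  ... | inj₂ (inj₁ x≺y) = x≺y
  ... | inj₂ (inj₂ y≺x) = ⊥-elim (true≢false (closed init y x y∈Ω y≺x x∈I) y∉I)

  -- A point of I outside J lies above all of J, so I would contain J and one point more.
  init-compare : ∀ {n} {Ω I J : PSet m n} → IsInit Ω I → IsInit Ω J → size I ≤ size J → I ⊆ J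
  init-compare {I = I} {J} initI initJ le x x∈I with J x in eq
  ... | true  = refl
  ... | false = ⊥-elim (<⇒≱ (size-mono-< {D = J} {I} J⊆I x eq x∈I) le)
    where
    J⊆I : J ⊆ I
    J⊆I y y∈J = closed initI y x (sub initJ y y∈J) (init-below initJ y x y∈J (sub initI x x∈I) eq) x∈I

  largest : ∀ {n k} {Ω : PSet m n} (W : Fin (suc k) → PSet m n) → (∀ i → IsInit Ω (W i)) → ∃ λ i → ∀ j → W j ⊆ W i
  largest {k = zero}  W init = zero , λ { zero x p → p }
  largest {k = suc k} W init with largest (W ∘ suc) (init ∘ suc)
  ... | i , top with ≤-total (size (W zero)) (size (W (suc i)))
  ...   | inj₁ le = suc i , λ { zero → init-compare (init zero) (init (suc i)) le ; (suc j) → top j }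
  ...   | inj₂ ge = zero , λ { zero x p → p ; (suc j) x p → init-compare (init (suc i)) (init zero) ge x (top j x p) }

  weight : ∀ {n} → (Point m n → ℕ) → PSet m n → ℕ
  weight f D = ∑ₚ λ x → ⟦ D x ⟧ * f x

  weight-mono : ∀ {n} f {D E : PSet m n} → D ⊆ E → weight f D ≤ weight f E
  weight-mono f D⊆E = ∑ₚ-mono-≤ λ x → *-monoˡ-≤ (f x) (⟦⟧-mono (D⊆E x))

  private
    ∑-*suc : ∀ {n} f (D : PSet m n) → ∑ₚ (λ x → ⟦ D x ⟧ * suc (f x)) ≡ size D + weight f D
    ∑-*suc f D = trans (∑ₚ-cong λ x → *-suc ⟦ D x ⟧ (f x)) (∑ₚ-+ (λ x → ⟦ D x ⟧) (λ x → ⟦ D x ⟧ * f x))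

  -- Replacing a set by the initial segment of the same size trades points
  -- outside the segment for smaller ones.
  init-weight : ∀ {n} {Ω I D : PSet m n} {f : Point m n → ℕ} → (∀ {x y} → x ≺ y → f x < f y) →
                IsInit Ω I → D ⊆ Ω → size I ≡ size D → D ⊆ I ⊎ weight f I < weight f D
  init-weight {n} {Ω} {I} {D} {f} mono init D⊆Ω |I|≡|D|
    with argmin {P = λ x → D x ≡ true × I x ≡ false} (λ x → (D x ≟ᵇ true) ×-dec (I x ≟ᵇ false)) f
  ... | inj₁ none = inj₁ D⊆I
    where
    D⊆I : D ⊆ I
    D⊆I x x∈D with I x in eq
    ... | true  = refl
    ... | false = ⊥-elim (none x (x∈D , eq))
  ... | inj₂ (z , (z∈D , z∉I) , least) = inj₂ (+-cancelˡ-< (size D + size D * θ) _ _ (begin-strict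
    size D + size D * θ + weight f I      ≡⟨ cong (λ k → k + size D * θ + weight f I) (sym |I|≡|D|) ⟩
    size I + size D * θ + weight f I      ≡⟨ rearrange (size I) (size D * θ) (weight f I) ⟩
    size I + weight f I + size D * θ      ≡⟨ cong₂ _+_ (sym (∑-*suc f I)) (sym (∑ₚ-*ʳ (λ x → ⟦ D x ⟧) θ)) ⟩
    ∑ₚ (λ x → ⟦ I x ⟧ * suc (f x)) + ∑ₚ (λ x → ⟦ D x ⟧ * θ)
                                          ≡⟨ sym (∑ₚ-+ (λ x → ⟦ I x ⟧ * suc (f x)) _) ⟩
    ∑ₚ (λ x → ⟦ I x ⟧ * suc (f x) + ⟦ D x ⟧ * θ)
                                          <⟨ ∑ₚ-mono-< pointwise z strictly ⟩
    ∑ₚ (λ x → ⟦ D x ⟧ * suc (f x) + ⟦ I x ⟧ * θ)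
                                          ≡⟨ ∑ₚ-+ (λ x → ⟦ D x ⟧ * suc (f x)) _ ⟩
    ∑ₚ (λ x → ⟦ D x ⟧ * suc (f x)) + ∑ₚ (λ x → ⟦ I x ⟧ * θ)
                                          ≡⟨ cong₂ _+_ (∑-*suc f D) (∑ₚ-*ʳ (λ x → ⟦ I x ⟧) θ) ⟩
    size D + weight f D + size I * θ      ≡⟨ cong (λ k → size D + weight f D + k * θ) |I|≡|D| ⟩
    size D + weight f D + size D * θ      ≡⟨ sym (rearrange (size D) (size D * θ) (weight f D)) ⟩
    size D + size D * θ + weight f D      ∎))
    where
    open ≤-Reasoning
    -- The least weight in D outside I is a threshold: points of I outside D lie below z, points of
    -- D outside I weigh at least θ. Weighing by `suc (f x)` makes z itself a place of strict
    -- inequality, so no point of I outside D has to be found.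
    θ = f z
    rearrange : ∀ a b c → a + b + c ≡ a + c + b
    rearrange a b c = trans (+-assoc a b c) (trans (cong (a +_) (+-comm b c)) (sym (+-assoc a c b)))
    pointwise : ∀ x → ⟦ I x ⟧ * suc (f x) + ⟦ D x ⟧ * θ ≤ ⟦ D x ⟧ * suc (f x) + ⟦ I x ⟧ * θ
    pointwise x with I x in x∈I | D x in x∈D
    ... | true  | true  = ≤-refl
    ... | false | false = ≤-refl
    ... | true  | false rewrite +-identityʳ (f x) | +-identityʳ (f x) | +-identityʳ θ =
      mono (init-below init x z x∈I (D⊆Ω z z∈D) z∉I)
    ... | false | true  rewrite +-identityʳ (f x) | +-identityʳ (f x) | +-identityʳ θ =
      m≤n⇒m≤1+n (least x (x∈D , x∈I))
    strictly : ⟦ I z ⟧ * suc (f z) + ⟦ D z ⟧ * θ < ⟦ D z ⟧ * suc (f z) + ⟦ I z ⟧ * θ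
    strictly rewrite z∈D | z∉I | +-identityʳ θ | +-identityʳ θ = ≤-refl

  init-weight-≤ : ∀ {n} {Ω I D : PSet m n} {f : Point m n → ℕ} → (∀ {x y} → x ≺ y → f x < f y) →
                  IsInit Ω I → D ⊆ Ω → size I ≡ size D → weight f I ≤ weight f D
  init-weight-≤ {I = I} {D} {f} mono init D⊆Ω eq with init-weight {f = f} mono init D⊆Ω eq
  ... | inj₂ lt  = <⇒≤ lt
  ... | inj₁ D⊆I = weight-mono f {I} {D} (⊆∧≥⇒⊇ {D = D} {I} D⊆I (≤-reflexive eq))

  weight-slice : ∀ {n} i (f : Point m (suc n) → ℕ) D →
                 weight f D ≡ sum (λ t → weight (λ u → f (insertAt u i t)) (slice i D t))
  weight-slice i f D = ∑ₚ-slice i (λ x → ⟦ D x ⟧ * f x)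

  weight-cong : ∀ {n} f {D E : PSet m n} → (∀ x → D x ≡ E x) → weight f D ≡ weight f E
  weight-cong f D≗E = ∑ₚ-cong λ x → cong (λ b → ⟦ b ⟧ * f x) (D≗E x)

  weight-glue : ∀ {n} i (f : Point m (suc n) → ℕ) W →
                weight f (glue i W) ≡ sum (λ t → weight (λ u → f (insertAt u i t)) (W t))
  weight-glue i f W = trans (weight-slice i f (glue i W))
                            (sum-cong-≗ λ t → weight-cong (λ u → f (insertAt u i t)) (slice-glue i W t))

  size-glue : ∀ {n} i (W : Fin m → PSet m n) → size (glue i W) ≡ sum (λ t → size (W t))
  size-glue i W = trans (size-slice i (glue i W)) (sum-cong-≗ λ t → size-cong (slice-glue i W t))

  module _ {n} (i : Fin (suc n)) {Ω E F : Fin m → PSet m n} (init : ∀ t → IsInit (Ω t) (F t))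
           (E⊆Ω : ∀ t → E t ⊆ Ω t) (|F|≡|E| : ∀ t → size (F t) ≡ size (E t)) where

    private
      code-mono : ∀ t {u v : Point m n} → u ≺ v → code (insertAt u i t) < code (insertAt v i t)
      code-mono t u≺v = ≺⇒code< (≺-insertAt i t u≺v)

      termwise : ∀ t → weight (λ u → code (insertAt u i t)) (F t) ≤ weight (λ u → code (insertAt u i t)) (E t)
      termwise t = init-weight-≤ {I = F t} {E t} (code-mono t) (init t) (E⊆Ω t) (|F|≡|E| t)

    -- Inserting a fixed coordinate preserves ≺, so on each slice the code is a strictly increasing
    -- function and `init-weight` applies slice by slice.
    glue-weight-≤ : weight code (glue i F) ≤ weight code (glue i E)
    glue-weight-≤ rewrite weight-glue i code F | weight-glue i code E = sum-mono-≤ termwise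

    glue-weight : (∀ t → E t ⊆ F t) ⊎ weight code (glue i F) < weight code (glue i E)
    glue-weight rewrite weight-glue i code F | weight-glue i code E =
      sum-choice termwise λ t → init-weight {I = F t} {E t} (code-mono t) (init t) (E⊆Ω t) (|F|≡|E| t)

  full : ∀ {n} → PSet m n
  full _ = true

  remove : ∀ {n} → Point m n → PSet m n → PSet m n
  remove x D y = D y ∧ not (eqₚ y x)

  size-remove : ∀ {n} (D : PSet m n) x → D x ≡ true → size D ≡ suc (size (remove x D))
  size-remove D x x∈D = begin
    size D
      ≡⟨ ∑ₚ-cong pointwise ⟩
    ∑ₚ (λ y → ⟦ eqₚ y x ⟧ + ⟦ remove x D y ⟧)
      ≡⟨ ∑ₚ-+ (λ y → ⟦ eqₚ y x ⟧) _ ⟩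
    ∑ₚ (λ y → ⟦ eqₚ y x ⟧) + size (remove x D)
      ≡⟨ cong (_+ size (remove x D)) (∑ₚ-δ true x) ⟩
    suc (size (remove x D)) ∎
    where
    open ≡-Reasoning
    pointwise : ∀ y → ⟦ D y ⟧ ≡ ⟦ eqₚ y x ⟧ + ⟦ remove x D y ⟧
    pointwise y with eqₚ y x in eq
    ... | false = cong ⟦_⟧ (sym (∧-identityʳ (D y)))
    ... | true rewrite eqₚ-sound y x eq | x∈D = refl

  remove-⊆ : ∀ {n} x (D : PSet m n) → remove x D ⊆ D
  remove-⊆ x D y p = proj₁ (∧-true p)

  x∉remove : ∀ {n} x (D : PSet m n) → remove x D x ≡ false
  x∉remove x D rewrite eqₚ-refl x = ∧-zeroʳ (D x)

  ∈remove : ∀ {n} {x y} {D : PSet m n} → D y ≡ true → y ≢ x → remove x D y ≡ true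
  ∈remove {x = x} {y} {D} y∈D y≢x with eqₚ y x in eq
  ... | true  = ⊥-elim (y≢x (eqₚ-sound y x eq))
  ... | false rewrite y∈D = refl

  shadow-empty : ∀ {n} i (D : PSet m (suc n)) u → (∀ t → D (insertAt u i t) ≡ false) → shadow i D u ≡ false
  shadow-empty i D u none = ¬true⇒false λ p → let t , q = shadow-elim i D u p in true≢false q (none t)

module _ {r : ℕ} where

  hasZero : ∀ {n} → PSet (suc r) n
  hasZero []          = false
  hasZero (zero ∷ u)  = true
  hasZero (suc _ ∷ u) = hasZero u

  hasZero-intro : ∀ {n} (x : Point (suc r) n) i → lookup x i ≡ zero → hasZero x ≡ true
  hasZero-intro (zero ∷ u)  i       p = refl
  hasZero-intro (suc _ ∷ u) (suc i) p = hasZero-intro u i p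

  hasZero-elim : ∀ {n} (x : Point (suc r) n) → hasZero x ≡ true → ∃ λ i → lookup x i ≡ zero
  hasZero-elim (zero ∷ u)  p = zero , refl
  hasZero-elim (suc _ ∷ u) p = let i , q = hasZero-elim u p in suc i , q

  slice-hasZero : ∀ {n} i t (u : Point (suc r) n) → slice i hasZero (suc t) u ≡ hasZero u
  slice-hasZero zero    t u           = refl
  slice-hasZero (suc i) t (zero ∷ u)  = refl
  slice-hasZero (suc i) t (suc _ ∷ u) = slice-hasZero i t u

  -- A maximal point x with xₗ = 0 is alone on its line in direction l.
  remove-max : ∀ {n} (U : PSet (suc r) n) → U ⊆ hasZero → ∀ x → U x ≡ true → (∀ y → U y ≡ true → code y ≤ code x) →
               suc (shadows (remove x U)) ≤ shadows U
  remove-max {zero} U U⊆X [] x∈U top with () ← U⊆X [] x∈U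
  remove-max {suc n} U U⊆X x x∈U top = sum-mono-< (λ i → size-mono {D = shadow i U′} {shadow i U} (shadow-mono i {U′} {U} (remove-⊆ x U))) l
    (size-mono-< {D = shadow l U′} {shadow l U} (shadow-mono l {U′} {U} (remove-⊆ x U)) (removeAt x l)
                 (shadow-empty l U′ (removeAt x l) none) (shadow-introₚ l U x x∈U))
    where
    U′ = remove x U
    l = proj₁ (hasZero-elim x (U⊆X x x∈U))
    xₗ≡0 : lookup x l ≡ zero
    xₗ≡0 = proj₂ (hasZero-elim x (U⊆X x x∈U))
    none : ∀ t → U′ (update x l t) ≡ false
    none zero = subst (λ y → U′ y ≡ false) (trans (sym (insertAt-removeAt x l)) (cong (insertAt (removeAt x l) l) xₗ≡0)) (x∉remove x U)
    none (suc t) = ¬true⇒false λ p →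
      <⇒≱ (≺⇒code< (≺-update x l (subst (F._< suc t) (sym xₗ≡0) (s≤s z≤n)))) (top _ (remove-⊆ x U _ p))

  -- `shadows≤` is the inequality between the gaps of `set` and U, written without subtraction. It
  -- is conditional because `trim` also cuts segments out of `full` in dimension 1.
  record Trimmed {n} (k : ℕ) (U : PSet (suc r) n) : Set where
    field
      set      : PSet (suc r) n
      isInit   : IsInit U set
      size≡    : size set ≡ k
      shadows≤ : U ⊆ hasZero → shadows set + size U ≤ shadows U + size set

  trim : ∀ {n} k (U : PSet (suc r) n) → k ≤ size U → Trimmed k U
  trim {n} k U k≤ = go (size U ∸ k) U (sym (m∸n+n≡m k≤))
    where
    go : ∀ d (U : PSet (suc r) n) → size U ≡ d + k → Trimmed k U
    go zero U eq = record
      { set = U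
      ; isInit = record { sub = λ x p → p ; closed = λ x y p _ _ → p }
      ; size≡ = eq
      ; shadows≤ = λ _ → ≤-refl }
    go (suc d) U eq with argmax (λ x → U x ≟ᵇ true) code
    ... | inj₁ none = ⊥-elim (0≢1+n (trans (sym (size-empty λ x → ¬true⇒false (none x))) eq))
    ... | inj₂ (x , x∈U , top) = record
      { set = set T
      ; isInit = record
        { sub = λ y p → remove-⊆ x U y (sub (isInit T) y p)
        ; closed = λ y z y∈U y≺z z∈B → closed (isInit T) y z
            (∈remove {D = U} y∈U λ { refl → <⇒≱ (≺⇒code< y≺z) (top z (remove-⊆ x U z (sub (isInit T) z z∈B))) })
            y≺z z∈B }
      ; size≡ = size≡ T
      ; shadows≤ = λ U⊆X → begin
          shadows (set T) + size U                    ≡⟨ cong (shadows (set T) +_) (size-remove U x x∈U) ⟩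
          shadows (set T) + suc (size (remove x U))   ≡⟨ +-suc _ _ ⟩
          suc (shadows (set T) + size (remove x U))   ≤⟨ s≤s (shadows≤ T λ y p → U⊆X y (remove-⊆ x U y p)) ⟩
          suc (shadows (remove x U)) + size (set T)   ≤⟨ +-monoˡ-≤ _ (remove-max U U⊆X x x∈U top) ⟩
          shadows U + size (set T)                    ∎ }
      where
      open ≤-Reasoning
      open Trimmed
      T : Trimmed k (remove x U)
      T = go d (remove x U) (suc-injective (trans (sym (size-remove U x x∈U)) eq))

-- Compressed sets

minimum : ∀ {k} (f : Fin (suc k) → ℕ) → ∃ λ i → ∀ j → f i ≤ f j
minimum {zero}  f = zero , λ { zero → ≤-refl }
minimum {suc k} f with minimum (f ∘ suc)
... | i , least with ≤-total (f zero) (f (suc i))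
...   | inj₁ le = zero , λ { zero → ≤-refl ; (suc j) → ≤-trans le (least j) }
...   | inj₂ ge = suc i , λ { zero → ge ; (suc j) → least j }

module _ {m : ℕ} where

  exchange : ∀ {n} → PSet m n → PSet m n → PSet m n → PSet m n
  exchange D L L′ x = D x ∧ not (L x) ∨ L′ x

  exchange-elim : ∀ {n} {D L L′ : PSet m n} x → exchange D L L′ x ≡ true →
                  (D x ≡ true × L x ≡ false) ⊎ L′ x ≡ true
  exchange-elim {D = D} {L} x p with D x | L x
  ... | true  | false = inj₁ (refl , refl)
  ... | true  | true  = inj₂ p
  ... | false | _     = inj₂ p

  module _ {n} {D L L′ : PSet m n} (L⊆D : L ⊆ D) (L′∩D=∅ : ∀ x → L′ x ≡ true → D x ≡ false)
           (|L|≡|L′| : size L ≡ size L′) where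

    exchange-size : size (exchange D L L′) ≡ size D
    exchange-size = +-cancelʳ-≡ (size L) _ _ (begin
      size (exchange D L L′) + size L                  ≡⟨ sym (∑ₚ-+ (λ x → ⟦ exchange D L L′ x ⟧) _) ⟩
      ∑ₚ (λ x → ⟦ exchange D L L′ x ⟧ + ⟦ L x ⟧)        ≡⟨ ∑ₚ-cong pointwise ⟩
      ∑ₚ (λ x → ⟦ D x ⟧ + ⟦ L′ x ⟧)                     ≡⟨ ∑ₚ-+ (λ x → ⟦ D x ⟧) _ ⟩
      size D + size L′                                 ≡⟨ cong (size D +_) (sym |L|≡|L′|) ⟩
      size D + size L                                  ∎)
      where
      open ≡-Reasoning
      pointwise : ∀ x → ⟦ exchange D L L′ x ⟧ + ⟦ L x ⟧ ≡ ⟦ D x ⟧ + ⟦ L′ x ⟧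
      pointwise x with D x in d | L x in l | L′ x in l′
      ... | true  | _     | true  = ⊥-elim (true≢false d (L′∩D=∅ x l′))
      ... | true  | true  | false = refl
      ... | true  | false | false = refl
      ... | false | true  | _     = ⊥-elim (true≢false (L⊆D x l) d)
      ... | false | false | true  = refl
      ... | false | false | false = refl

    -- θ separates the added points from equally many removed ones; each added point gains at least
    -- 1, which the extra summand `size L′` records.
    exchange-weight : ∀ f θ → (∀ x → L′ x ≡ true → f x < θ) → (∀ x → L x ≡ true → θ ≤ f x) → 0 < size L →
                      weight f (exchange D L L′) < weight f D
    exchange-weight f θ below above L≢∅ = +-cancelʳ-< (size L * θ) _ _ (begin-strict
      weight f D′ + size L * θ               <⟨ m<m+n _ (subst (0 <_) |L|≡|L′| L≢∅) ⟩
      weight f D′ + size L * θ + size L′     ≡⟨ cong (λ k → weight f D′ + k + size L′) (sym (∑ₚ-*ʳ (λ x → ⟦ L x ⟧) θ)) ⟩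
      weight f D′ + ∑ₚ (λ x → ⟦ L x ⟧ * θ) + size L′
                                             ≡⟨ cong (_+ size L′) (sym (∑ₚ-+ (λ x → ⟦ D′ x ⟧ * f x) _)) ⟩
      ∑ₚ (λ x → ⟦ D′ x ⟧ * f x + ⟦ L x ⟧ * θ) + size L′
                                             ≡⟨ sym (∑ₚ-+ (λ x → ⟦ D′ x ⟧ * f x + ⟦ L x ⟧ * θ) _) ⟩
      ∑ₚ (λ x → ⟦ D′ x ⟧ * f x + ⟦ L x ⟧ * θ + ⟦ L′ x ⟧)
                                             ≤⟨ ∑ₚ-mono-≤ pointwise ⟩
      ∑ₚ (λ x → ⟦ D x ⟧ * f x + ⟦ L′ x ⟧ * θ) ≡⟨ ∑ₚ-+ (λ x → ⟦ D x ⟧ * f x) _ ⟩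
      weight f D + ∑ₚ (λ x → ⟦ L′ x ⟧ * θ)    ≡⟨ cong (weight f D +_) (∑ₚ-*ʳ (λ x → ⟦ L′ x ⟧) θ) ⟩
      weight f D + size L′ * θ               ≡⟨ cong (λ k → weight f D + k * θ) (sym |L|≡|L′|) ⟩
      weight f D + size L * θ                ∎)
      where
      open ≤-Reasoning
      D′ = exchange D L L′
      pointwise : ∀ x → ⟦ D′ x ⟧ * f x + ⟦ L x ⟧ * θ + ⟦ L′ x ⟧ ≤ ⟦ D x ⟧ * f x + ⟦ L′ x ⟧ * θ
      pointwise x with D x in d | L x in l | L′ x in l′
      ... | true  | _     | true  = ⊥-elim (true≢false d (L′∩D=∅ x l′))
      ... | false | true  | _     = ⊥-elim (true≢false (L⊆D x l) d)
      ... | true  | false | false rewrite +-identityʳ (f x + 0 + 0) = ≤-refl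
      ... | false | false | false = z≤n
      ... | true  | true  | false rewrite +-identityʳ (θ + 0) | +-identityʳ θ | +-identityʳ (f x + 0) | +-identityʳ (f x) = above x l
      ... | false | false | true  rewrite +-identityʳ (f x + 0) | +-identityʳ (f x) | +-identityʳ θ | +-comm (f x) 1 = below x l′

  line : ∀ {n} → Fin (suc n) → (Fin m → Bool) → Point m n → PSet m (suc n)
  line i f p = glue i λ t u → f t ∧ eqₚ u p

  size-line : ∀ {n} i f (p : Point m n) → size (line i f p) ≡ sum (λ t → ⟦ f t ⟧)
  size-line i f p = trans (size-glue i λ t u → f t ∧ eqₚ u p) (sum-cong-≗ λ t → ∑ₚ-δ (f t) p)

  line-elim : ∀ {n} i f (x z : Point m (suc n)) → line i f (removeAt x i) z ≡ true →
              f (lookup z i) ≡ true × z ≡ update x i (lookup z i)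
  line-elim i f x z p with ∧-true p
  ... | q , e = q , trans (sym (insertAt-removeAt z i)) (cong (λ u → insertAt u i (lookup z i)) (eqₚ-sound (removeAt z i) (removeAt x i) e))

  line-intro : ∀ {n} i f (x : Point m (suc n)) t → f t ≡ true → line i f (removeAt x i) (update x i t) ≡ true
  line-intro i f x t p rewrite lookup-update x i t | removeAt-insertAt (removeAt x i) i t | p = eqₚ-refl (removeAt x i)

  decides-update : ∀ {n} (x y : Point m (suc n)) {i j} → i ≢ j → Decides x y j → Decides x (update y i (lookup x i)) j
  decides-update x y {i} {j} i≢j (xⱼ<yⱼ , d) rewrite lookup-update-≢ y i (lookup x i) i≢j =
    xⱼ<yⱼ , punchIn-cases i (inj₁ (sym (lookup-update y i _))) other
    where
    z = update y i (lookup x i)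
    other : ∀ k → lookup x (punchIn i k) ≡ lookup z (punchIn i k) ⊎
                  ((lookup x (punchIn i k) , punchIn i k) ⊑ (lookup y j , j) ×
                   (lookup z (punchIn i k) , punchIn i k) ⊑ (lookup y j , j))
    other k rewrite lookup-update-punchIn y i (lookup x i) k = d (punchIn i k)

  update-insertAt : ∀ {n} (u : Point m n) i s t → update (insertAt u i s) i t ≡ insertAt u i t
  update-insertAt u i s t = cong (λ v → insertAt v i t) (removeAt-insertAt u i s)

  update-same : ∀ {n} (x : Point m (suc n)) i {a} → a ≡ lookup x i → update x i a ≡ x
  update-same x i refl = insertAt-removeAt x i

module _ {r : ℕ} where

  -- The closure properties shared by ℕⁿ and X_n on which the exchange rests, so that one argument
  -- serves both. In X_n the point y of `spread` has a zero coordinate, which forces q = 0.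
  record IsDomain {n} (Ω : PSet (suc r) (suc n)) : Set where
    field
      down   : ∀ x i a → Ω x ≡ true → a F.≤ lookup x i → Ω (update x i a) ≡ true
      spread : ∀ x y j q → Ω x ≡ true → Ω y ≡ true → (∀ i → q F.≤ lookup y i) → Ω (update x j q) ≡ true

  full-domain : ∀ {n} → IsDomain {n} full
  full-domain = record { down = λ _ _ _ _ _ → refl ; spread = λ _ _ _ _ _ _ _ → refl }

  ≤zero : ∀ {a : Fin (suc r)} → a F.≤ F.zero {r} → a ≡ zero
  ≤zero {zero} _ = refl

  hasZero-domain : ∀ {n} → IsDomain {n} hasZero
  hasZero-domain = record
    { down = λ x i a p a≤ → let l , xₗ≡0 = hasZero-elim x p in down x i a l a≤ xₗ≡0
    ; spread = λ x y j q _ p q≤ → let l , yₗ≡0 = hasZero-elim y p in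
        hasZero-intro (update x j q) j (trans (lookup-update x j q) (≤zero (subst (q F.≤_) yₗ≡0 (q≤ l)))) }
    where
    down : ∀ x i a l → a F.≤ lookup x i → lookup x l ≡ zero → hasZero (update x i a) ≡ true
    down x i a l a≤ xₗ≡0 with i F.≟ l
    ... | yes refl = hasZero-intro (update x i a) i (trans (lookup-update x i a) (≤zero (subst (a F.≤_) xₗ≡0 a≤)))
    ... | no i≢l   = hasZero-intro (update x i a) l (trans (lookup-update-≢ x i a i≢l) xₗ≡0)

  -- What initial slices yield in all directions at once: points with a common coordinate lie in a
  -- common slice.
  Compressed : ∀ {n} → PSet (suc r) n → PSet (suc r) n → Set
  Compressed Ω D = ∀ x y → Ω x ≡ true → x ≺ y → D y ≡ true → (∃ λ i → lookup x i ≡ lookup y i) → D x ≡ true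

  record Improvement {n} (Ω D : PSet (suc r) n) : Set where
    field
      set      : PSet (suc r) n
      inside   : set ⊆ Ω
      size≡    : size set ≡ size D
      shadows≤ : shadows set ≤ shadows D
      weight<  : weight code set < weight code D

  module Exchange {n} {Ω D : PSet (suc r) (suc (suc n))} (dom : IsDomain Ω) (D⊆Ω : D ⊆ Ω) (comp : Compressed Ω D)
    {x y} (x∈Ω : Ω x ≡ true) (x∉D : D x ≡ false) (x-least : ∀ z → Ω z ≡ true → D z ≡ false → code x ≤ code z)
    (y∈D : D y ≡ true) (y-greatest : ∀ z → D z ≡ true → code z ≤ code y)
    {j} (d : Decides x y j) where

    open IsDomain dom

    differ : ∀ i → lookup x i ≢ lookup y i
    differ i e = true≢false (comp x y x∈Ω (j ▹ d) y∈D (i , e)) x∉D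

    rank : ∀ i → (lookup x i , i) ⊑ (lookup y j , j) × (lookup y i , i) ⊑ (lookup y j , j)
    rank i with proj₂ d i
    ... | inj₁ e = ⊥-elim (differ i e)
    ... | inj₂ p = p

    below-x : ∀ z → Ω z ≡ true → z ≺ x → D z ≡ true
    below-x z z∈Ω z≺x with D z in eq
    ... | true  = refl
    ... | false = ⊥-elim (<⇒≱ (≺⇒code< z≺x) (x-least z z∈Ω eq))

    -- If xᵢ < yᵢ for some i ≠ j, then y with its i-th value lowered to xᵢ lies
    -- strictly between x and y and shares a coordinate with each of them.
    yᵢ<xᵢ : ∀ i → i ≢ j → lookup y i F.< lookup x i
    yᵢ<xᵢ i i≢j with FP.<-cmp (lookup x i) (lookup y i)
    ... | tri> _ _ yᵢ<xᵢ = yᵢ<xᵢ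
    ... | tri≈ _ e _     = ⊥-elim (differ i e)
    ... | tri< xᵢ<yᵢ _ _ with D (update y i (lookup x i)) in eq
    ...   | true  = ⊥-elim (true≢false (comp x (update y i (lookup x i)) x∈Ω (j ▹ decides-update x y i≢j d) eq (i , sym (lookup-update y i _))) x∉D)
    ...   | false = ⊥-elim (true≢false (comp (update y i (lookup x i)) y (down y i _ (D⊆Ω y y∈D) (<⇒≤ xᵢ<yᵢ)) (update-≺ y i xᵢ<yᵢ) y∈D
                                             (j , lookup-update-≢ y i _ i≢j)) eq)

    -- Now all coordinates of x are positive. Lowering any one of them to 0 gives a smaller point of
    -- Ω, present in D by the choice of x, so adding x creates no new projected point in any
    -- direction.
    swap : lookup x j ≢ zero → Improvement Ω D
    swap xⱼ≢0 = record
      { set = D′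
      ; inside = D′⊆Ω
      ; size≡ = exchange-size {D = D} {L} {L′} L⊆D L′∩D=∅ |L|≡|L′|
      ; shadows≤ = shadows-mono-shadow {D = D′} {D} shadow-⊆
      ; weight< = exchange-weight {D = D} {L} {L′} L⊆D L′∩D=∅ |L|≡|L′| code (code y)
          (λ z p → subst (λ z → code z < code y) (sym (eqₚ-sound z x p)) (≺⇒code< {x = x} {y} (j ▹ d)))
          (λ z p → ≤-reflexive (cong code (sym (eqₚ-sound z y p))))
          (subst (0 <_) (sym (∑ₚ-δ true y)) ≤-refl) }
      where
      L L′ D′ : PSet (suc r) (suc (suc n))
      L z = eqₚ z y
      L′ z = eqₚ z x
      D′ = exchange D L L′
      L⊆D : L ⊆ D
      L⊆D z p = subst (λ z → D z ≡ true) (sym (eqₚ-sound z y p)) y∈D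
      L′∩D=∅ : ∀ z → L′ z ≡ true → D z ≡ false
      L′∩D=∅ z p = subst (λ z → D z ≡ false) (sym (eqₚ-sound z x p)) x∉D
      |L|≡|L′| : size L ≡ size L′
      |L|≡|L′| = trans (∑ₚ-δ true y) (sym (∑ₚ-δ true x))
      D′⊆Ω : D′ ⊆ Ω
      D′⊆Ω z p with exchange-elim {D = D} {L} {L′} z p
      ... | inj₁ (z∈D , _) = D⊆Ω z z∈D
      ... | inj₂ q         = subst (λ z → Ω z ≡ true) (sym (eqₚ-sound z x q)) x∈Ω
      0<x : ∀ k → F.zero {r} F.< lookup x k
      0<x k with k F.≟ j
      ... | yes refl = n≢0⇒n>0 (λ e → xⱼ≢0 (FP.toℕ-injective {i = lookup x j} {zero} e))
      ... | no k≢j   = ≤-<-trans z≤n (yᵢ<xᵢ k k≢j)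
      shadow-⊆ : ∀ k → shadow k D′ ⊆ shadow k D
      shadow-⊆ k u p with shadow-elim k D′ u p
      ... | t , q with exchange-elim {D = D} {L} {L′} (insertAt u k t) q
      ...   | inj₁ (z∈D , _) = shadow-intro k D t u z∈D
      ...   | inj₂ e = shadow-intro k D zero u (subst (λ z → D z ≡ true) x₀≡
                         (below-x (update x k zero) (down x k zero x∈Ω z≤n) (update-≺ x k (0<x k))))
        where
        x₀≡ : update x k zero ≡ insertAt u k zero
        x₀≡ = trans (cong (λ z → update z k zero) (sym (eqₚ-sound (insertAt u k t) x e))) (update-insertAt u k t zero)

    -- When xⱼ = 0, adding x alone may cost a new point of π_j; removing a
    -- shortest full line through y pays for it.
    swap-line : lookup x j ≡ zero → Improvement Ω D
    swap-line xⱼ≡0 = record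
      { set = D′
      ; inside = D′⊆Ω
      ; size≡ = exchange-size {D = D} {L} {L′} L⊆D L′∩D=∅ |L|≡|L′|
      ; shadows≤ = +-cancelʳ-≤ 1 _ _ (begin
          shadows D′ + 1
            ≡⟨ cong (shadows D′ +_) (sym (δ-sum i)) ⟩
          shadows D′ + sum (λ k → ⟦ does (k F.≟ i) ⟧)
            ≡⟨ sym (∑-distrib-+ (λ k → size (shadow k D′)) (λ k → ⟦ does (k F.≟ i) ⟧)) ⟩
          sum (λ k → size (shadow k D′) + ⟦ does (k F.≟ i) ⟧)
            ≤⟨ sum-mono-≤ shadow-≤ ⟩
          sum (λ k → size (shadow k D) + ⟦ does (k F.≟ j) ⟧)
            ≡⟨ ∑-distrib-+ (λ k → size (shadow k D)) (λ k → ⟦ does (k F.≟ j) ⟧) ⟩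
          shadows D + sum (λ k → ⟦ does (k F.≟ j) ⟧)
            ≡⟨ cong (shadows D +_) (δ-sum j) ⟩
          shadows D + 1 ∎)
      ; weight< = exchange-weight {D = D} {L} {L′} L⊆D L′∩D=∅ |L|≡|L′| code (code (update y i zero)) L′-below L-above
          (subst (0 <_) (sym (size-line i f _)) (≤-trans (≤-reflexive (sym (cong ⟦_⟧ (dec-true (v F.≤? v) ≤-refl)))) (term≤sum (λ t → ⟦ f t ⟧) v))) }
      where
      open ≤-Reasoning
      i : Fin (suc (suc n))
      -- A least coordinate of y apart from j. Since v = yᵢ < xᵢ ≤ yⱼ, v is the minimum over all
      -- coordinates of y.
      i = punchIn j (proj₁ (minimum λ k → toℕ (lookup y (punchIn j k))))
      i≢j : i ≢ j
      i≢j = FP.punchInᵢ≢i j _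
      v : Fin (suc r)
      v = lookup y i
      v≤y : ∀ k → k ≢ j → v F.≤ lookup y k
      v≤y k k≢j = subst (λ k → v F.≤ lookup y k) (FP.punchIn-punchOut (k≢j ∘ sym))
                        (proj₂ (minimum λ k → toℕ (lookup y (punchIn j k))) _)
      v<yⱼ : v F.< lookup y j
      v<yⱼ = <-≤-trans (yᵢ<xᵢ i i≢j) (⊑⇒≤ {i = i} {j} (proj₁ (rank i)))
      v≤y′ : ∀ k → v F.≤ lookup y k
      v≤y′ k with k F.≟ j
      ... | yes refl = <⇒≤ v<yⱼ
      ... | no k≢j   = v≤y k k≢j
      -- Both lines use the heights 0 to v: `L` in direction i ends at y, `L′` in direction j starts
      -- at x. Hence they have the same size.
      f : Fin (suc r) → Bool
      f t = does (t F.≤? v)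
      f-elim : ∀ {t} → f t ≡ true → t F.≤ v
      f-elim {t} p = does-true (t F.≤? v) p
      L L′ D′ : PSet (suc r) (suc (suc n))
      L = line i f (removeAt y i)
      L′ = line j f (removeAt x j)
      D′ = exchange D L L′
      |L|≡|L′| : size L ≡ size L′
      |L|≡|L′| = trans (size-line i f _) (sym (size-line j f _))
      -- Points of `L` below y share the coordinate j with y, so compressedness puts them in D.
      L⊆D : L ⊆ D
      L⊆D z p with line-elim i f y z p
      ... | q , e with m≤n⇒m<n∨m≡n (f-elim q)
      ...   | inj₂ zᵢ≡v = subst (λ z → D z ≡ true) (sym (trans e (update-same y i (FP.toℕ-injective zᵢ≡v)))) y∈D
      ...   | inj₁ zᵢ<v = subst (λ z → D z ≡ true) (sym e)
                (comp (update y i (lookup z i)) y (down y i _ (D⊆Ω y y∈D) (<⇒≤ zᵢ<v)) (update-≺ y i zᵢ<v) y∈D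
                      (j , lookup-update-≢ y i _ i≢j))
      -- A point of `L′` above x shares the coordinate i with x; if it were in D, compressedness
      -- would put x there too.
      L′∩D=∅ : ∀ z → L′ z ≡ true → D z ≡ false
      L′∩D=∅ z p with line-elim j f x z p
      ... | _ , e with lookup z j in eq
      ...   | zero  = subst (λ z → D z ≡ false) (sym (trans e (update-same x j (sym xⱼ≡0)))) x∉D
      ...   | suc t = ¬true⇒false λ z∈D → true≢false
                (comp x z x∈Ω (subst (x ≺_) (sym e) (≺-update x j (subst (F._< suc t) (sym xⱼ≡0) (s≤s z≤n)))) z∈D
                      (i , trans (sym (lookup-update-≢ x j (suc t) (i≢j ∘ sym))) (cong (λ z → lookup z i) (sym e)))) x∉D
      L-above : ∀ z → L z ≡ true → code (update y i zero) ≤ code z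
      L-above z p with line-elim i f y z p
      ... | _ , e with lookup z i
      ...   | zero  = ≤-reflexive (cong code (sym e))
      ...   | suc t = <⇒≤ (≺⇒code< (subst (update y i zero ≺_) (sym e) (insertAt-≺ (removeAt y i) i (s≤s z≤n))))
      -- The threshold is the lowest removed point. Coordinate j still decides: zⱼ ≤ v < yⱼ, and all
      -- other values of both points rank no higher than yⱼ at j.
      L′-below : ∀ z → L′ z ≡ true → code z < code (update y i zero)
      L′-below z p with line-elim j f x z p
      ... | q , e = ≺⇒code< {x = z} {update y i zero} (j ▹ (lt , punchIn-cases j (inj₂ (inj₁ lt , inj₂ (refl , ≤-refl))) other))
        where
        y₀ = update y i zero
        y₀ⱼ : lookup y₀ j ≡ lookup y j
        y₀ⱼ = lookup-update-≢ y i zero i≢j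
        lt : lookup z j F.< lookup y₀ j
        lt = subst (lookup z j F.<_) (sym y₀ⱼ) (≤-<-trans (f-elim q) v<yⱼ)
        y₀ₖ⊑ : ∀ k → (lookup y₀ k , k) ⊑ (lookup y₀ j , j)
        y₀ₖ⊑ k rewrite y₀ⱼ with i F.≟ k
        ... | yes refl rewrite lookup-update y i zero = inj₁ (≤-<-trans z≤n v<yⱼ)
        ... | no i≢k rewrite lookup-update-≢ y i zero i≢k = proj₂ (rank k)
        zₖ≡ : ∀ k → lookup z (punchIn j k) ≡ lookup x (punchIn j k)
        zₖ≡ k = trans (cong (λ z → lookup z (punchIn j k)) e) (lookup-update-punchIn x j _ k)
        zₖ⊑ : ∀ k → (lookup z (punchIn j k) , punchIn j k) ⊑ (lookup y₀ j , j)
        zₖ⊑ k rewrite y₀ⱼ | zₖ≡ k = proj₁ (rank (punchIn j k))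
        other : ∀ k → lookup z (punchIn j k) ≡ lookup y₀ (punchIn j k) ⊎
                      ((lookup z (punchIn j k) , punchIn j k) ⊑ (lookup y₀ j , j) ×
                       (lookup y₀ (punchIn j k) , punchIn j k) ⊑ (lookup y₀ j , j))
        other k = inj₂ (zₖ⊑ k , y₀ₖ⊑ (punchIn j k))
      L′⊆Ω : L′ ⊆ Ω
      L′⊆Ω z p with line-elim j f x z p
      ... | q , e = subst (λ z → Ω z ≡ true) (sym e) (spread x y j _ x∈Ω (D⊆Ω y y∈D) λ k → ≤-trans (f-elim q) (v≤y′ k))
      D′⊆Ω : D′ ⊆ Ω
      D′⊆Ω z p with exchange-elim {D = D} {L} {L′} z p
      ... | inj₁ (z∈D , _) = D⊆Ω z z∈D
      ... | inj₂ q         = L′⊆Ω z q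
      -- Lowering coordinate k of a new point z to 0 gives a point before x, decided at k because zⱼ
      -- ≤ v ≤ yₖ < xₖ. By the choice of x it is already in D.
      shadow-⊆ : ∀ k → k ≢ j → shadow k D′ ⊆ shadow k D
      shadow-⊆ k k≢j u p with shadow-elim k D′ u p
      ... | t , q with exchange-elim {D = D} {L} {L′} (insertAt u k t) q
      ...   | inj₁ (z∈D , _) = shadow-intro k D t u z∈D
      ...   | inj₂ z∈L′ with line-elim j f x (insertAt u k t) z∈L′
      ...     | fz , e = shadow-intro k D zero u
                  (below-x w (subst (λ w → Ω w ≡ true) (update-insertAt u k t zero) (down z k zero (L′⊆Ω z z∈L′) z≤n))
                             (k ▹ (lt , λ l → other l (l F.≟ k) (l F.≟ j))))
        where
        z = insertAt u k t
        w = insertAt u k zero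
        wₖ≡0 : lookup w k ≡ zero
        wₖ≡0 = insertAt-lookup u k zero
        lt : lookup w k F.< lookup x k
        lt rewrite wₖ≡0 = ≤-<-trans z≤n (yᵢ<xᵢ k k≢j)
        zⱼ<xₖ : lookup z j F.< lookup x k
        zⱼ<xₖ = ≤-<-trans (≤-trans (f-elim fz) (v≤y k k≢j)) (yᵢ<xᵢ k k≢j)
        other : ∀ l → Dec (l ≡ k) → Dec (l ≡ j) → lookup w l ≡ lookup x l ⊎
                  ((lookup w l , l) ⊑ (lookup x k , k) × (lookup x l , l) ⊑ (lookup x k , k))
        other l (yes refl) _ = inj₂ (inj₁ lt , inj₂ (refl , ≤-refl))
        other l (no l≢k) (yes refl) =
          inj₂ (inj₁ (subst (F._< lookup x k) (lookup-insertAt-≢ u k t zero (l≢k ∘ sym)) zⱼ<xₖ)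
               , inj₁ (subst (F._< lookup x k) (sym xⱼ≡0) (≤-<-trans z≤n (yᵢ<xᵢ k k≢j))))
        other l (no l≢k) (no l≢j) =
          inj₁ (trans (lookup-insertAt-≢ u k zero t (l≢k ∘ sym))
                      (trans (cong (λ z → lookup z l) e) (lookup-update-≢ x j _ (l≢j ∘ sym))))
      -- Heights up to v have been removed, greater heights would beat the greatest point y, and
      -- points of `L′` have j-th value at most v < yⱼ.
      yᵢ-line-empty : ∀ t → D′ (update y i t) ≡ false
      yᵢ-line-empty t = ¬true⇒false λ p → case (exchange-elim {D = D} {L} {L′} (update y i t) p)
        where
        case : (D (update y i t) ≡ true × L (update y i t) ≡ false) ⊎ L′ (update y i t) ≡ true → ⊥
        case (inj₁ (z∈D , z∉L)) with t F.≤? v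
        ... | yes t≤v = true≢false (line-intro i f y t (dec-true (t F.≤? v) t≤v)) z∉L
        ... | no  t≰v = <⇒≱ (≺⇒code< (≺-update y i (≰⇒> t≰v))) (y-greatest _ z∈D)
        case (inj₂ z∈L′) = <⇒≱ v<yⱼ (subst (F._≤ v) (lookup-update-≢ y i t i≢j)
                                          (f-elim (proj₁ (line-elim j f x (update y i t) z∈L′))))
      -- The balance per direction: π_i loses a point, π_j gains at most one because all of `L′`
      -- projects to a single point, and the others do not grow.
      shadow-≤ : ∀ k → size (shadow k D′) + ⟦ does (k F.≟ i) ⟧ ≤ size (shadow k D) + ⟦ does (k F.≟ j) ⟧
      shadow-≤ k with k F.≟ i | k F.≟ j
      ... | yes refl | yes k≡j = ⊥-elim (i≢j k≡j)
      ... | yes refl | no k≢j  = begin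
        size (shadow i D′) + 1  ≡⟨ +-comm _ 1 ⟩
        suc (size (shadow i D′)) ≤⟨ size-mono-< {D = shadow i D′} {shadow i D} (shadow-⊆ i k≢j) (removeAt y i)
                                     (shadow-empty i D′ (removeAt y i) yᵢ-line-empty) (shadow-introₚ i D y y∈D) ⟩
        size (shadow i D)       ≡⟨ sym (+-identityʳ _) ⟩
        size (shadow i D) + 0   ∎
      ... | no _ | no k≢j   = +-monoˡ-≤ 0 (size-mono {D = shadow k D′} {shadow k D} (shadow-⊆ k k≢j))
      ... | no _ | yes refl = begin
        size (shadow j D′) + 0  ≡⟨ +-identityʳ _ ⟩
        size (shadow j D′)      ≤⟨ ∑ₚ-mono-≤ pointwise ⟩
        ∑ₚ (λ u → ⟦ shadow j D u ⟧ + ⟦ eqₚ u (removeAt x j) ⟧)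
                                ≡⟨ ∑ₚ-+ (λ u → ⟦ shadow j D u ⟧) (λ u → ⟦ eqₚ u (removeAt x j) ⟧) ⟩
        size (shadow j D) + ∑ₚ (λ u → ⟦ eqₚ u (removeAt x j) ⟧)
                                ≡⟨ cong (size (shadow j D) +_) (∑ₚ-δ true (removeAt x j)) ⟩
        size (shadow j D) + 1   ∎
        where
        pointwise : ∀ u → ⟦ shadow j D′ u ⟧ ≤ ⟦ shadow j D u ⟧ + ⟦ eqₚ u (removeAt x j) ⟧
        pointwise u with shadow j D′ u in s
        ... | false = z≤n
        ... | true with shadow-elim j D′ u s
        ...   | t , q with exchange-elim {D = D} {L} {L′} (insertAt u j t) q
        ...     | inj₁ (z∈D , _) rewrite shadow-intro j D t u z∈D = s≤s z≤n
        ...     | inj₂ z∈L′ = ≤-trans (≤-reflexive (cong ⟦_⟧ (sym u≡p))) (m≤n+m _ ⟦ shadow j D u ⟧)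
          where
          u≡p : eqₚ u (removeAt x j) ≡ true
          u≡p = subst (λ u → eqₚ u (removeAt x j) ≡ true) (removeAt-insertAt u j t) (proj₂ (∧-true z∈L′))

    improvement : Improvement Ω D
    improvement with lookup x j F.≟ zero
    ... | yes xⱼ≡0 = swap-line xⱼ≡0
    ... | no xⱼ≢0  = swap xⱼ≢0

  improve : ∀ {n} {Ω D : PSet (suc r) (suc (suc n))} → IsDomain Ω → D ⊆ Ω → Compressed Ω D → IsInit Ω D ⊎ Improvement Ω D
  improve {Ω = Ω} {D} dom D⊆Ω comp
    with argmin {P = λ x → Ω x ≡ true × D x ≡ false} (λ x → (Ω x ≟ᵇ true) ×-dec (D x ≟ᵇ false)) code
       | argmax {P = λ x → D x ≡ true} (λ x → D x ≟ᵇ true) code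
  ... | inj₁ none | _ = inj₁ record
    { sub = D⊆Ω
    ; closed = λ x y x∈Ω _ _ → ¬false⇒true λ x∉D → none x (x∈Ω , x∉D) }
  ... | inj₂ _ | inj₁ none = inj₁ record { sub = D⊆Ω ; closed = λ x y _ _ y∈D → ⊥-elim (none y y∈D) }
  ... | inj₂ (x , (x∈Ω , x∉D) , least) | inj₂ (y , y∈D , greatest) with x ≺? y
  ...   | yes (j ▹ d) = inj₂ (Exchange.improvement dom D⊆Ω comp x∈Ω x∉D (λ z p q → least z (p , q)) y∈D greatest d)
  ...   | no x⊀y = inj₁ record
    { sub = D⊆Ω
    ; closed = λ z w z∈Ω z≺w w∈D → ¬false⇒true λ z∉D →
        x⊀y (code<⇒≺ (≤-<-trans (least z (z∈Ω , z∉D)) (<-≤-trans (≺⇒code< z≺w) (greatest w w∈D)))) }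

  record Optimum {n} (Ω A : PSet (suc r) n) : Set where
    field
      set      : PSet (suc r) n
      isInit   : IsInit Ω set
      size≡    : size set ≡ size A
      shadows≤ : shadows set ≤ shadows A

  optimise : ∀ {n} {Ω : PSet (suc r) (suc (suc n))} → IsDomain Ω →
             (∀ D → D ⊆ Ω → Compressed Ω D ⊎ Improvement Ω D) → ∀ D → D ⊆ Ω → Optimum Ω D
  optimise {n} {Ω} dom compress D D⊆Ω = go D D⊆Ω (<-wellFounded _)
    where
    go : ∀ D → D ⊆ Ω → Acc _<_ (weight code D) → Optimum Ω D
    continue : ∀ D → Acc _<_ (weight code D) → Improvement Ω D → Optimum Ω D
    continue D (acc rec) imp = record
      { set = Optimum.set O
      ; isInit = Optimum.isInit O
      ; size≡ = trans (Optimum.size≡ O) size≡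
      ; shadows≤ = ≤-trans (Optimum.shadows≤ O) shadows≤ }
      where
      open Improvement imp
      O : Optimum Ω set
      O = go set inside (rec weight<)
    go D D⊆Ω a with compress D D⊆Ω
    ... | inj₂ imp = continue D a imp
    ... | inj₁ comp with improve dom D⊆Ω comp
    ...   | inj₂ imp  = continue D a imp
    ...   | inj₁ init = record { set = D ; isInit = init ; size≡ = refl ; shadows≤ = ≤-refl }

-- Compression

below : ∀ {n} → (Fin n → Bool) → Fin n → Bool
below f zero    = false
below f (suc t) = f zero ∨ below (f ∘ suc) t

below-intro : ∀ {n} (f : Fin n → Bool) {s t} → s F.< t → f s ≡ true → below f t ≡ true
below-intro f {zero}  {suc t} _         p rewrite p = refl
below-intro f {suc s} {suc t} (s≤s s<t) p = ∨-introʳ (f zero) (below-intro (f ∘ suc) s<t p)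

below-elim : ∀ {n} (f : Fin n → Bool) t → below f t ≡ true → ∃ λ s → s F.< t × f s ≡ true
below-elim f (suc t) p with ∨-true {f zero} p
... | inj₁ q = zero , s≤s z≤n , q
... | inj₂ q = let s , s<t , e = below-elim (f ∘ suc) t q in suc s , s≤s s<t , e

-- Only the lowest element has nothing below it, and there is one exactly when the line is nonempty.
sum-any : ∀ {n} (f : Fin n → Bool) → ⟦ anyᵇ f ⟧ + sum (λ t → ⟦ f t ∧ below f t ⟧) ≡ sum (λ t → ⟦ f t ⟧)
sum-any {zero}  f = refl
sum-any {suc n} f with f zero
... | true  = cong suc (sum-cong-≗ λ t → cong ⟦_⟧ (∧-identityʳ (f (suc t))))
... | false = sum-any (f ∘ suc)

sum-any-weight : ∀ {n} (f : Fin n → Bool) b (w : Fin n → ℕ) → (∀ t → b ≤ w t) →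
                 ⟦ anyᵇ f ⟧ * b + sum (λ t → ⟦ f t ∧ below f t ⟧ * w t) ≤ sum (λ t → ⟦ f t ⟧ * w t)
sum-any-weight {zero}  f b w b≤w = z≤n
sum-any-weight {suc n} f b w b≤w with f zero
... | true  = +-mono-≤ (+-monoˡ-≤ 0 (b≤w zero))
                       (≤-reflexive (sum-cong-≗ λ t → cong (λ c → ⟦ c ⟧ * w (suc t)) (∧-identityʳ (f (suc t)))))
... | false = sum-any-weight (f ∘ suc) b (w ∘ suc) (b≤w ∘ suc)

-- Moves the lowest element of a nonempty subset of a line down to 0.
drop-bottom : ∀ {r} → (Fin (suc r) → Bool) → Fin (suc r) → Bool
drop-bottom f zero    = anyᵇ f
drop-bottom f (suc t) = f (suc t) ∧ below f (suc t)

sum-drop-bottom : ∀ {r} (f : Fin (suc r) → Bool) → sum (λ t → ⟦ drop-bottom f t ⟧) ≡ sum (λ t → ⟦ f t ⟧)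
sum-drop-bottom f = trans (cong (λ c → ⟦ anyᵇ f ⟧ + (⟦ c ⟧ + sum (λ t → ⟦ drop-bottom f (suc t) ⟧))) (sym (∧-zeroʳ (f zero))))
                          (sum-any f)

weight-drop-bottom-≤ : ∀ {r} (f : Fin (suc r) → Bool) (w : Fin (suc r) → ℕ) → (∀ t → w zero < w (suc t)) →
                       sum (λ t → ⟦ drop-bottom f t ⟧ * w t) ≤ sum (λ t → ⟦ f t ⟧ * w t)
weight-drop-bottom-≤ f w w₀<w = ≤-trans
  (≤-reflexive (cong (λ c → ⟦ anyᵇ f ⟧ * w zero + (⟦ c ⟧ * w zero + sum (λ t → ⟦ drop-bottom f (suc t) ⟧ * w (suc t)))) (sym (∧-zeroʳ (f zero)))))
  (sum-any-weight f (w zero) w λ { zero → ≤-refl ; (suc t) → <⇒≤ (w₀<w t) })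

weight-drop-bottom-< : ∀ {r} (f : Fin (suc r) → Bool) (w : Fin (suc r) → ℕ) → (∀ t → w zero < w (suc t)) →
                       f zero ≡ false → anyᵇ f ≡ true →
                       sum (λ t → ⟦ drop-bottom f t ⟧ * w t) < sum (λ t → ⟦ f t ⟧ * w t)
weight-drop-bottom-< f w w₀<w f₀ some with f zero
-- With height 0 vacant, every element weighs at least `suc (w zero)`; this bound for the lowest one
-- supplies the strictness.
weight-drop-bottom-< f w w₀<w refl some | false = ≤-trans
  (≤-reflexive (cong (λ c → suc (⟦ c ⟧ * w zero + rest)) some))
  (≤-trans (≤-reflexive (cong (λ c → ⟦ c ⟧ * suc (w zero) + rest) (sym some)))
           (≤-trans (sum-any-weight (f ∘ suc) (suc (w zero)) (w ∘ suc) w₀<w) ≤-refl))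
  where
  rest = sum (λ t → ⟦ f (suc t) ∧ below (f ∘ suc) t ⟧ * w (suc t))

-- `i′` is the place that direction i takes among the coordinates left after `punchIn i k` is
-- deleted.
insertAt-comm : ∀ {m n} (i : Fin (suc (suc n))) (k : Fin (suc n)) → ∃ λ i′ → ∀ (w : Point m n) s t →
                insertAt (insertAt w i′ t) (punchIn i k) s ≡ insertAt (insertAt w k s) i t
insertAt-comm zero    k       = zero , λ w s t → refl
insertAt-comm (suc i) zero    = i , λ w s t → refl
insertAt-comm {n = suc n} (suc i) (suc k) =
  let i′ , e = insertAt-comm i k in suc i′ , λ { (a ∷ w) s t → cong (a ∷_) (e w s t) }

-- A projection along any other direction keeps the coordinate i, so it splits over the slices.
shadows-slice : ∀ {m n} i (D : PSet m (suc n)) → shadows D ≡ size (shadow i D) + sum (λ t → shadows (slice i D t))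
shadows-slice {m} {zero}  zero D = cong (size (shadow zero D) +_) (sym (sum-replicate-zero m))
shadows-slice {m} {suc n} i    D = begin
  sum (λ k → size (shadow k D))
    ≡⟨ sum-remove {i = i} (λ k → size (shadow k D)) ⟩
  size (shadow i D) + sum (λ k → size (shadow (punchIn i k) D))
    ≡⟨ cong (size (shadow i D) +_) (sum-cong-≗ perShadow) ⟩
  size (shadow i D) + sum (λ k → sum λ t → size (shadow k (slice i D t)))
    ≡⟨ cong (size (shadow i D) +_) (∑-comm λ k t → size (shadow k (slice i D t))) ⟩
  size (shadow i D) + sum (λ t → shadows (slice i D t)) ∎
  where
  open ≡-Reasoning
  perShadow : ∀ k → size (shadow (punchIn i k) D) ≡ sum (λ t → size (shadow k (slice i D t)))
  perShadow k with insertAt-comm {m} i k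
  ... | i′ , e = trans (size-slice i′ (shadow (punchIn i k) D))
                       (sum-cong-≗ λ t → ∑ₚ-cong λ w → cong ⟦_⟧ (anyᵇ-cong λ s → cong D (e w s t)))

⊆-init : ∀ {m n} {Ω I E : PSet m n} → IsInit Ω I → E ⊆ I → size I ≡ size E → IsInit Ω E
⊆-init {I = I} {E} init E⊆I eq = record
  { sub = λ x p → sub init x (E⊆I x p)
  ; closed = λ x y x∈Ω x≺y p → ⊆∧≥⇒⊇ {D = E} {I} E⊆I (≤-reflexive eq) x (closed init x y x∈Ω x≺y (E⊆I y p)) }

glue-⊆ : ∀ {m n} i {W : Fin m → PSet m n} {Ω : PSet m (suc n)} → (∀ t → W t ⊆ slice i Ω t) → glue i W ⊆ Ω
glue-⊆ i {Ω = Ω} W⊆ x p = trans (sym (glue-slice i Ω x)) (W⊆ _ _ p)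

glue-shadows : ∀ {m n} i (W : Fin m → PSet m n) K → (∀ t → W t ⊆ K) →
               shadows (glue i W) ≤ size K + sum (λ t → shadows (W t))
glue-shadows i W K W⊆K = begin
  shadows (glue i W)
    ≡⟨ shadows-slice i (glue i W) ⟩
  size (shadow i (glue i W)) + sum (λ t → shadows (slice i (glue i W) t))
    ≤⟨ +-mono-≤ (size-mono {D = shadow i (glue i W)} {K} shadow⊆K)
                (sum-mono-≤ λ t → shadows-mono {D = slice i (glue i W) t} {W t} λ u p → trans (sym (slice-glue i W t u)) p) ⟩
  size K + sum (λ t → shadows (W t)) ∎
  where
  open ≤-Reasoning
  shadow⊆K : shadow i (glue i W) ⊆ K
  shadow⊆K u p = let t , q = shadow-elim i (glue i W) u p in W⊆K t u (trans (sym (slice-glue i W t u)) q)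

module _ {r : ℕ} where

  slices⇒compressed : ∀ {n} {Ω D : PSet (suc r) (suc n)} → (∀ i t → IsInit (slice i Ω t) (slice i D t)) → Compressed Ω D
  slices⇒compressed {Ω = Ω} {D} init x y x∈Ω x≺y y∈D (i , xᵢ≡yᵢ) =
    trans (cong D (sym x≡)) (closed (init i (lookup x i)) (removeAt x i) (removeAt y i)
      (trans (cong Ω x≡) x∈Ω)
      (≺-insertAt⁻ i (lookup x i) (subst₂ _≺_ (sym x≡) (sym y≡) x≺y))
      (trans (cong D y≡) y∈D))
    where
    x≡ : update x i (lookup x i) ≡ x
    x≡ = update-same x i refl
    y≡ : update y i (lookup x i) ≡ y
    y≡ = update-same y i xᵢ≡yᵢ

  -- The new slices are nested, so the projection along i lies in the largest of them, whose size is
  -- that of a slice of D and hence at most that of π_i(D).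
  compress-full : ∀ {n} → (∀ D → Optimum {r} {n} full D) → ∀ i (D : PSet (suc r) (suc n)) →
                  (∀ t → IsInit (slice i full t) (slice i D t)) ⊎ Improvement full D
  compress-full {n} opt i D with glue-weight i {λ _ → full} {slice i D} {λ t → Optimum.set (opt (slice i D t))}
      (λ t → Optimum.isInit (opt (slice i D t))) (λ _ _ _ → refl) (λ t → Optimum.size≡ (opt (slice i D t)))
  ... | inj₁ E⊆F = inj₁ λ t → ⊆-init (Optimum.isInit (opt (slice i D t))) (E⊆F t) (Optimum.size≡ (opt (slice i D t)))
  ... | inj₂ lt = inj₂ record
    { set = glue i F
    ; inside = λ _ _ → refl
    ; size≡ = trans (size-glue i F) (trans (sum-cong-≗ λ t → Optimum.size≡ (opt (slice i D t))) (sym (size-slice i D)))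
    ; shadows≤ = begin
        shadows (glue i F)
          ≤⟨ glue-shadows i F (F top) (proj₂ best) ⟩
        size (F top) + sum (λ t → shadows (F t))
          ≤⟨ +-mono-≤ (≤-trans (≤-reflexive (Optimum.size≡ (opt (slice i D top))))
                               (size-mono {D = slice i D top} {shadow i D} λ u → shadow-intro i D top u))
                      (sum-mono-≤ λ t → Optimum.shadows≤ (opt (slice i D t))) ⟩
        size (shadow i D) + sum (λ t → shadows (slice i D t))
          ≡⟨ sym (shadows-slice i D) ⟩
        shadows D ∎
    ; weight< = <-≤-trans lt (≤-reflexive (weight-cong code (glue-slice i D))) }
    where
    open ≤-Reasoning
    F : Fin (suc r) → PSet (suc r) n
    F t = Optimum.set (opt (slice i D t))
    best : ∃ λ t → ∀ s → F s ⊆ F t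
    best = largest F λ t → Optimum.isInit (opt (slice i D t))
    top = proj₁ best

  module _ {n} (i : Fin (suc n)) (A : PSet (suc r) (suc n)) where

    -- The slice at height 0 is the projection π_i(A).
    dropped : Fin (suc r) → PSet (suc r) n
    dropped t u = drop-bottom (λ s → A (insertAt u i s)) t

    size-dropped : sum (λ t → size (dropped t)) ≡ size A
    size-dropped = begin
      sum (λ t → size (dropped t))
        ≡⟨ sum-∑ₚ-comm (λ t u → ⟦ dropped t u ⟧) ⟩
      ∑ₚ (λ u → sum λ t → ⟦ dropped t u ⟧)
        ≡⟨ ∑ₚ-cong (λ u → sum-drop-bottom (λ s → A (insertAt u i s))) ⟩
      ∑ₚ (λ u → sum λ t → ⟦ A (insertAt u i t) ⟧)
        ≡⟨ sym (sum-∑ₚ-comm (λ t u → ⟦ A (insertAt u i t) ⟧)) ⟩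
      sum (λ t → size (slice i A t))
        ≡⟨ sym (size-slice i A) ⟩
      size A ∎
      where open ≡-Reasoning

    private
      f : Point (suc r) n → Fin (suc r) → Bool
      f u t = A (insertAt u i t)

      w : Point (suc r) n → Fin (suc r) → ℕ
      w u t = code (insertAt u i t)

      w-mono : ∀ u t → w u zero < w u (suc t)
      w-mono u t = ≺⇒code< (insertAt-≺ u i (s≤s z≤n))

      weight-dropped : weight code (glue i dropped) ≡ ∑ₚ (λ u → sum λ t → ⟦ drop-bottom (f u) t ⟧ * w u t)
      weight-dropped = trans (weight-glue i code dropped) (sum-∑ₚ-comm λ t u → ⟦ dropped t u ⟧ * w u t)

      weight-A : weight code A ≡ ∑ₚ (λ u → sum λ t → ⟦ f u t ⟧ * w u t)
      weight-A = trans (weight-slice i code A) (sum-∑ₚ-comm λ t u → ⟦ f u t ⟧ * w u t)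

    weight-dropped-≤ : weight code (glue i dropped) ≤ weight code A
    weight-dropped-≤ = begin
      weight code (glue i dropped)                             ≡⟨ weight-dropped ⟩
      ∑ₚ (λ u → sum λ t → ⟦ drop-bottom (f u) t ⟧ * w u t)      ≤⟨ ∑ₚ-mono-≤ (λ u → weight-drop-bottom-≤ (f u) (w u) (w-mono u)) ⟩
      ∑ₚ (λ u → sum λ t → ⟦ f u t ⟧ * w u t)                    ≡⟨ sym weight-A ⟩
      weight code A                                            ∎
      where open ≤-Reasoning

    weight-dropped-< : ∀ u → A (insertAt u i zero) ≡ false → shadow i A u ≡ true →
                       weight code (glue i dropped) < weight code A
    weight-dropped-< u p q = begin-strict
      weight code (glue i dropped)                             ≡⟨ weight-dropped ⟩
      ∑ₚ (λ u → sum λ t → ⟦ drop-bottom (f u) t ⟧ * w u t)      <⟨ ∑ₚ-mono-< (λ u → weight-drop-bottom-≤ (f u) (w u) (w-mono u)) u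
                                                                    (weight-drop-bottom-< (f u) (w u) (w-mono u) p q) ⟩
      ∑ₚ (λ u → sum λ t → ⟦ f u t ⟧ * w u t)                    ≡⟨ sym weight-A ⟩
      weight code A                                            ∎
      where open ≤-Reasoning

  -- Fix k and a line in direction i after projecting along k. A dropped point over it at positive
  -- height comes with a lower point of A over the same line, so the dropped slices project into the
  -- `drop-bottom` of the projected line, which has as many points as that line.
  shadows-dropped : ∀ {n} i (A : PSet (suc r) (suc n)) →
                    sum (λ t → shadows (dropped i A t)) ≤ sum (λ t → shadows (slice i A t))
  shadows-dropped {zero}  i A = ≤-refl
  shadows-dropped {suc n} i A = begin
    sum (λ t → sum λ k → size (shadow k (dropped i A t)))
      ≡⟨ ∑-comm (λ t k → size (shadow k (dropped i A t))) ⟩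
    sum (λ k → sum λ t → size (shadow k (dropped i A t)))
      ≤⟨ sum-mono-≤ perShadow ⟩
    sum (λ k → sum λ t → size (shadow k (slice i A t)))
      ≡⟨ ∑-comm (λ k t → size (shadow k (slice i A t))) ⟩
    sum (λ t → sum λ k → size (shadow k (slice i A t))) ∎
    where
    open ≤-Reasoning
    g : Fin (suc n) → Point (suc r) n → Fin (suc r) → Bool
    g k w t = shadow k (slice i A t) w
    dropped⇒g : ∀ k w t → shadow k (dropped i A t) w ≡ true → drop-bottom (g k w) t ≡ true
    dropped⇒g k w zero p =
      let s , q = shadow-elim k (dropped i A zero) w p
          t , a = shadow-elim i A (insertAt w k s) q
      in anyᵇ-intro (g k w) t (shadow-intro k (slice i A t) s w a)
    dropped⇒g k w (suc t) p =
      let s , q      = shadow-elim k (dropped i A (suc t)) w p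
          a , b      = ∧-true q
          t′ , t′<t , a′ = below-elim (λ t → A (insertAt (insertAt w k s) i t)) (suc t) b
      in cong₂ _∧_ (shadow-intro k (slice i A (suc t)) s w a)
                   (below-intro (g k w) t′<t (shadow-intro k (slice i A t′) s w a′))
    perShadow : ∀ k → sum (λ t → size (shadow k (dropped i A t))) ≤ sum (λ t → size (shadow k (slice i A t)))
    perShadow k = begin
      sum (λ t → size (shadow k (dropped i A t)))
        ≡⟨ sum-∑ₚ-comm (λ t w → ⟦ shadow k (dropped i A t) w ⟧) ⟩
      ∑ₚ (λ w → sum λ t → ⟦ shadow k (dropped i A t) w ⟧)
        ≤⟨ ∑ₚ-mono-≤ (λ w → ≤-trans (sum-mono-≤ λ t → ⟦⟧-mono (dropped⇒g k w t)) (≤-reflexive (sum-drop-bottom (g k w)))) ⟩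
      ∑ₚ (λ w → sum λ t → ⟦ g k w t ⟧)
        ≡⟨ sym (sum-∑ₚ-comm (λ t w → ⟦ g k w t ⟧)) ⟩
      sum (λ t → size (shadow k (slice i A t))) ∎

  Antichain : ∀ {n} → PSet (suc r) n → Set
  Antichain A = ∀ x y → A x ≡ true → A y ≡ true → ¬ (∀ i → lookup x i F.< lookup y i)

  -- If u < v in every remaining coordinate, replace u by a lower point of A on its line: then the
  -- coordinate i increases as well, against the antichain property of A.
  dropped-antichain : ∀ {n} i (A : PSet (suc r) (suc n)) → Antichain A → ∀ t → Antichain (dropped i A (suc t))
  dropped-antichain i A anti t u v p q u<v =
    let s , s<t , a = below-elim (λ t → A (insertAt u i t)) (suc t) (proj₂ (∧-true p))
    in anti (insertAt u i s) (insertAt v i (suc t)) a (proj₁ (∧-true q))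
         (punchIn-cases i (subst₂ F._<_ (sym (insertAt-lookup u i s)) (sym (insertAt-lookup v i (suc t))) s<t)
                          λ k → subst₂ F._<_ (sym (insertAt-punchIn u i s k)) (sym (insertAt-punchIn v i (suc t) k)) (u<v k))

  -- The initial segment of ℕⁿ generated by I, expressed through codes to be decidable.
  closure : ∀ {n} → PSet (suc r) n → PSet (suc r) n
  closure I u = does (anyₚ? λ q → (I q ≟ᵇ true) ×-dec (code u ℕ.≤? code q))

  closure-intro : ∀ {n} (I : PSet (suc r) n) u q → I q ≡ true → code u ≤ code q → closure I u ≡ true
  closure-intro I u q p le = dec-true (anyₚ? _) (q , p , le)

  closure-elim : ∀ {n} (I : PSet (suc r) n) u → closure I u ≡ true → ∃ λ q → I q ≡ true × code u ≤ code q
  closure-elim I u = does-true (anyₚ? _)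

  closure-init : ∀ {n} (I : PSet (suc r) n) → IsInit full (closure I)
  closure-init I = record
    { sub = λ _ _ → refl
    ; closed = λ x y _ x≺y p → let q , q∈I , le = closure-elim I y p in
        closure-intro I x q q∈I (≤-trans (<⇒≤ (≺⇒code< x≺y)) le) }

  -- Lowering a coordinate to 0 puts a point of the closure back into X_n.
  shadows-closure : ∀ {n} {I : PSet (suc r) n} → IsInit hasZero I → shadows (closure I) ≤ shadows I
  shadows-closure {zero}  init = z≤n
  shadows-closure {suc n} {I} init = shadows-mono-shadow {D = closure I} {I} shadow-⊆
    where
    shadow-⊆ : ∀ k → shadow k (closure I) ⊆ shadow k I
    shadow-⊆ k u p with shadow-elim k (closure I) u p
    ... | t , c with closure-elim I (insertAt u k t) c
    ...   | q , q∈I , le with m≤n⇒m<n∨m≡n (≤-trans (zero-least t) le)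
      where
      zero-least : ∀ t → code (insertAt u k zero) ≤ code (insertAt u k t)
      zero-least zero    = ≤-refl
      zero-least (suc t) = <⇒≤ (≺⇒code< (insertAt-≺ u k (s≤s z≤n)))
    ...     | inj₁ lt = shadow-intro k I zero u
                (closed init (insertAt u k zero) q (hasZero-intro (insertAt u k zero) k (insertAt-lookup u k zero)) (code<⇒≺ lt) q∈I)
    ...     | inj₂ eq = shadow-intro k I zero u (subst (λ z → I z ≡ true) (sym (code-injective eq)) q∈I)

  -- A first compression moves an arbitrary antichain into X_n. Progress is claimed for sets already
  -- there, which is what the later rounds start from.
  record Compression {n} (i : Fin (suc n)) (A : PSet (suc r) (suc n)) : Set where
    field
      set      : PSet (suc r) (suc n)
      inside   : set ⊆ hasZero
      size≡    : size set ≡ size A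
      shadows≤ : shadows set ≤ shadows A
      weight<  : A ⊆ hasZero → (∀ t → IsInit (slice i hasZero t) (slice i A t)) ⊎ weight code set < weight code A

  module Compress {n} (opt : ∀ D → Optimum {r} {n} full D) (optX : ∀ (A : PSet (suc r) n) → Antichain A → Optimum hasZero A)
                  (i : Fin (suc n)) (A : PSet (suc r) (suc n)) (anti : Antichain A) where

    E : Fin (suc r) → PSet (suc r) n
    E = dropped i A

    O₀ : Optimum full (shadow i A)
    O₀ = opt (shadow i A)

    O : ∀ t → Optimum hasZero (E (suc t))
    O t = optX (E (suc t)) (dropped-antichain i A anti t)

    F : Fin (suc r) → PSet (suc r) n
    F zero    = Optimum.set O₀
    F (suc t) = Optimum.set (O t)

    |F|≡|E| : ∀ t → size (F t) ≡ size (E t)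
    |F|≡|E| zero    = Optimum.size≡ O₀
    |F|≡|E| (suc t) = Optimum.size≡ (O t)

    F-init : ∀ t → IsInit (slice i hasZero t) (F t)
    F-init zero    = IsInit-cong (λ u → sym (hasZero-intro (insertAt u i zero) i (insertAt-lookup u i zero))) (λ _ → refl) (Optimum.isInit O₀)
    F-init (suc t) = IsInit-cong (λ u → sym (slice-hasZero i t u)) (λ _ → refl) (Optimum.isInit (O t))

    -- Taking closures turns all slices into initial segments of one and the same order, so that one
    -- of them contains the rest.
    candidate : Fin (suc r) → PSet (suc r) n
    candidate zero    = F zero
    candidate (suc t) = closure (F (suc t))

    candidate-init : ∀ t → IsInit full (candidate t)
    candidate-init zero    = Optimum.isInit O₀
    candidate-init (suc t) = closure-init (F (suc t))

    -- Each positive slice is contained in π_i(A) before it is optimised. Hence whichever candidate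
    -- ends up at height 0, its s is covered by that of π_i(A), even when its size is larger.
    candidate-shadows : ∀ t → shadows (candidate t) ≤ shadows (shadow i A)
    candidate-shadows zero    = Optimum.shadows≤ O₀
    candidate-shadows (suc t) = ≤-trans (shadows-closure (Optimum.isInit (O t)))
      (≤-trans (Optimum.shadows≤ (O t))
               (shadows-mono {D = E (suc t)} {shadow i A} λ u p → shadow-intro i A (suc t) u (proj₁ (∧-true p))))

    -- The slice at height 0 must contain all the others for the projection
    -- along i to be no larger than it.
    best : ∃ λ t → ∀ s → candidate s ⊆ candidate t
    best = largest candidate candidate-init

    K : PSet (suc r) n
    K = candidate (proj₁ best)

    F⊆K : ∀ t → F t ⊆ K
    F⊆K zero      = proj₂ best zero
    F⊆K (suc t) u p = proj₂ best (suc t) u (closure-intro (F (suc t)) u u p ≤-refl)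

    G : Fin (suc r) → PSet (suc r) n
    G zero    = K
    G (suc t) = F (suc t)

    G⊆K : ∀ t → G t ⊆ K
    G⊆K zero    u p = p
    G⊆K (suc t) u p = F⊆K (suc t) u p

    F⊆G : ∀ t → F t ⊆ G t
    F⊆G zero    = F⊆K zero
    F⊆G (suc t) u p = p

    G⊆hasZero : ∀ t → G t ⊆ slice i hasZero t
    G⊆hasZero zero    u p = hasZero-intro (insertAt u i zero) i (insertAt-lookup u i zero)
    G⊆hasZero (suc t) u p = sub (F-init (suc t)) u p

    U : PSet (suc r) (suc n)
    U = glue i G

    V : PSet (suc r) (suc n)
    V = glue i F

    U⊆hasZero : U ⊆ hasZero
    U⊆hasZero = glue-⊆ i {G} {hasZero} G⊆hasZero

    V⊆U : V ⊆ U
    V⊆U x p = F⊆G (lookup x i) (removeAt x i) p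

    |V|≡|A| : size V ≡ size A
    |V|≡|A| = trans (size-glue i F) (trans (sum-cong-≗ |F|≡|E|) (size-dropped i A))

    -- In terms of gaps: replacing π_i(A) by K changes the bound on the projection along i and the
    -- total size by the same number, and all other terms do not grow.
    U-shadows : shadows U + size A ≤ shadows A + size U
    U-shadows = begin
      shadows U + size A
        ≤⟨ +-monoˡ-≤ (size A) (glue-shadows i G K G⊆K) ⟩
      size K + sum (λ t → shadows (G t)) + size A
        ≤⟨ +-monoˡ-≤ (size A) (+-monoʳ-≤ (size K) (≤-trans (sum-mono-≤ G-shadows) (shadows-dropped i A))) ⟩
      size K + Σs + size A
        ≡⟨ cong (size K + Σs +_) (trans (sym (size-dropped i A)) (cong (size (shadow i A) +_) (sym (sum-cong-≗ (λ t → |F|≡|E| (suc t)))))) ⟩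
      size K + Σs + (size (shadow i A) + Σf)
        ≡⟨ rearrange (size K) Σs (size (shadow i A)) Σf ⟩
      size (shadow i A) + Σs + (size K + Σf)
        ≡⟨ cong₂ _+_ (sym (shadows-slice i A)) (sym (size-glue i G)) ⟩
      shadows A + size U ∎
      where
      open ≤-Reasoning
      Σs Σf : ℕ
      Σs = sum (λ t → shadows (slice i A t))
      Σf = sum (λ t → size (F (suc t)))
      G-shadows : ∀ t → shadows (G t) ≤ shadows (E t)
      G-shadows zero    = candidate-shadows (proj₁ best)
      G-shadows (suc t) = Optimum.shadows≤ (O t)
      rearrange : ∀ a b c d → a + b + (c + d) ≡ c + b + (a + d)
      rearrange = solve-∀

    T : Trimmed (size A) U
    T = trim (size A) U (subst (_≤ size U) |V|≡|A| (size-mono {D = V} {U} V⊆U))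

    open Trimmed T

    -- The trimmed set is an initial segment of U with as many points as V ⊆ U, so it is no heavier
    -- than V: the detour through the enlarged U cannot undo the progress made by V.
    weight-≤ : A ⊆ hasZero → weight code set ≤ weight code (glue i E) ×
                             ((∀ t → E t ⊆ F t) ⊎ weight code set < weight code (glue i E))
    weight-≤ A⊆X = ≤-trans B≤V (glue-weight-≤ i F-init E⊆hasZero |F|≡|E|) , dichotomy (glue-weight i F-init E⊆hasZero |F|≡|E|)
      where
      E⊆hasZero : ∀ t → E t ⊆ slice i hasZero t
      E⊆hasZero zero    u p = hasZero-intro (insertAt u i zero) i (insertAt-lookup u i zero)
      E⊆hasZero (suc t) u p = A⊆X (insertAt u i (suc t)) (proj₁ (∧-true p))
      B≤V : weight code set ≤ weight code V
      B≤V = init-weight-≤ {I = set} {V} ≺⇒code< isInit V⊆U (trans size≡ (sym |V|≡|A|))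
      dichotomy : (∀ t → E t ⊆ F t) ⊎ weight code V < weight code (glue i E) →
                  (∀ t → E t ⊆ F t) ⊎ weight code set < weight code (glue i E)
      dichotomy (inj₁ p)  = inj₁ p
      dichotomy (inj₂ lt) = inj₂ (≤-<-trans B≤V lt)

    compression : Compression i A
    compression = record
      { set = set
      ; inside = λ x p → U⊆hasZero x (sub isInit x p)
      ; size≡ = size≡
      ; shadows≤ = +-cancelʳ-≤ (size U) _ _ (begin
          shadows set + size U  ≤⟨ shadows≤ U⊆hasZero ⟩
          shadows U + size set  ≡⟨ cong (shadows U +_) size≡ ⟩
          shadows U + size A    ≤⟨ U-shadows ⟩
          shadows A + size U    ∎)
      ; weight< = dichotomy }
      where
      open ≤-Reasoning
      dichotomy : A ⊆ hasZero → (∀ t → IsInit (slice i hasZero t) (slice i A t)) ⊎ weight code set < weight code A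
      dichotomy A⊆X = cases (weight-≤ A⊆X) (nonempty? missing)
        where
        -- Lines that meet A but not at height 0. If one exists, moving its lowest point down is a
        -- strict gain; if none does, the dropped slices are the slices of A.
        missing : PSet (suc r) n
        missing u = shadow i A u ∧ not (A (insertAt u i zero))
        slices-init : (∀ u → missing u ≡ false) → (∀ t → E t ⊆ F t) → ∀ t → IsInit (slice i hasZero t) (slice i A t)
        slices-init none E⊆F t = IsInit-cong (λ _ → refl) (E≗A t) (⊆-init (F-init t) (E⊆F t) (|F|≡|E| t))
          where
          at-zero : ∀ u → shadow i A u ≡ true → A (insertAt u i zero) ≡ true
          at-zero u p = ¬false⇒true λ q → true≢false (cong₂ (λ a b → a ∧ not b) p q) (none u)
          E≗A : ∀ t u → E t u ≡ A (insertAt u i t)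
          E≗A zero    u = ⇔⇒≡ (at-zero u) (shadow-intro i A zero u)
          E≗A (suc t) u = ⇔⇒≡ (λ p → proj₁ (∧-true p)) λ p → cong₂ _∧_ p
            (below-intro (λ s → A (insertAt u i s)) {zero} {suc t} (s≤s z≤n) (at-zero u (shadow-intro i A (suc t) u p)))
        cases : weight code set ≤ weight code (glue i E) × ((∀ t → E t ⊆ F t) ⊎ weight code set < weight code (glue i E)) →
                (∃ λ u → missing u ≡ true) ⊎ (∀ u → missing u ≡ false) →
                (∀ t → IsInit (slice i hasZero t) (slice i A t)) ⊎ weight code set < weight code A
        cases (_ , inj₂ lt)   _              = inj₂ (<-≤-trans lt (weight-dropped-≤ i A))
        cases (le , inj₁ _)   (inj₁ (u , p)) = inj₂ (≤-<-trans le (weight-dropped-< i A u (not-true (proj₂ (∧-true p))) (proj₁ (∧-true p))))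
        cases (_ , inj₁ E⊆F)  (inj₂ none)    = inj₁ (slices-init none E⊆F)

  abstract
    compression : ∀ {n} → (∀ D → Optimum {r} {n} full D) → (∀ (A : PSet (suc r) n) → Antichain A → Optimum hasZero A) →
                  ∀ i (A : PSet (suc r) (suc n)) → Antichain A → Compression i A
    compression = Compress.compression

  -- Optimality by induction on the dimension

  hasZero-antichain : ∀ {n} {A : PSet (suc r) n} → A ⊆ hasZero → Antichain A
  hasZero-antichain A⊆X x y _ y∈A x<y = let l , yₗ≡0 = hasZero-elim y (A⊆X y y∈A) in
    n≮0 (subst (lookup x l F.<_) yₗ≡0 (x<y l))

  full-optimum₀ : ∀ (D : PSet (suc r) 0) → Optimum full D
  full-optimum₀ D = record
    { set = D
    ; isInit = record { sub = λ _ _ → refl ; closed = λ { _ _ _ (() ▹ _) _ } }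
    ; size≡ = refl
    ; shadows≤ = ≤-refl }

  -- In dimension 1, s is 1 for a nonempty set and 0 for the empty one, so any initial segment of
  -- the right size will do.
  full-optimum₁ : ∀ (D : PSet (suc r) 1) → Optimum full D
  full-optimum₁ D = record
    { set = set
    ; isInit = isInit
    ; size≡ = size≡
    ; shadows≤ = shadows-mono-shadow {D = set} {D} λ { zero [] p → shadow-set (shadow-elim zero set [] p) (nonempty? D) } }
    where
    everything : PSet (suc r) 1
    everything = full
    T : Trimmed (size D) everything
    T = trim (size D) everything (size-mono {D = D} {everything} λ _ _ → refl)
    open Trimmed T
    shadow-set : (∃ λ t → set (t ∷ []) ≡ true) → (∃ λ x → D x ≡ true) ⊎ (∀ x → D x ≡ false) → shadow zero D [] ≡ true
    shadow-set _       (inj₁ (t ∷ [] , q)) = shadow-intro zero D t [] q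
    shadow-set (t , q) (inj₂ empty)        =
      ⊥-elim (<⇒≱ (size-mono-< {D = D} {set} (λ x p → ⊥-elim (true≢false p (empty x))) (t ∷ []) (empty (t ∷ [])) q)
                  (≤-reflexive size≡))

  full-optimum-step : ∀ {n} → (∀ D → Optimum {r} {suc n} full D) → ∀ D → Optimum {r} {suc (suc n)} full D
  full-optimum-step opt D = optimise full-domain
    (λ D _ → ⊎-map slices⇒compressed proj₂ (finite-choice λ i → compress-full opt i D)) D (λ _ _ → refl)

  full-optimum : ∀ n (D : PSet (suc r) n) → Optimum full D
  full-optimum zero          = full-optimum₀
  full-optimum (suc zero)    = full-optimum₁
  full-optimum (suc (suc n)) = full-optimum-step (full-optimum (suc n))

  -- The empty vector is vacuously below itself, so A is empty.
  antichain-optimum₀ : ∀ (A : PSet (suc r) 0) → Antichain A → Optimum hasZero A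
  antichain-optimum₀ A anti = record
    { set = A
    ; isInit = record { sub = λ { [] p → ⊥-elim (anti [] [] p p λ ()) } ; closed = λ { _ _ _ (() ▹ _) _ } }
    ; size≡ = refl
    ; shadows≤ = ≤-refl }

  -- X_1 is a single point and all its subsets are initial segments, so one compression finishes.
  antichain-optimum₁ : ∀ (A : PSet (suc r) 1) → Antichain A → Optimum hasZero A
  antichain-optimum₁ A anti = record
    { set = set
    ; isInit = record { sub = inside ; closed = λ x y x∈X x≺y p → ⊥-elim (singleton x y x∈X (inside y p) x≺y) }
    ; size≡ = size≡
    ; shadows≤ = shadows≤ }
    where
    open Compression (compression full-optimum₀ antichain-optimum₀ zero A anti)
    singleton : ∀ x y → hasZero x ≡ true → hasZero y ≡ true → ¬ x ≺ y
    singleton (zero ∷ []) (zero ∷ []) _ _ = ≺-irrefl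

  antichain-optimum-step : ∀ {n} → (∀ D → Optimum {r} {suc n} full D) →
                           (∀ (A : PSet (suc r) (suc n)) → Antichain A → Optimum hasZero A) →
                           ∀ (A : PSet (suc r) (suc (suc n))) → Antichain A → Optimum hasZero A
  antichain-optimum-step {n} opt optX A anti = record
    { set = Optimum.set O
    ; isInit = Optimum.isInit O
    ; size≡ = trans (Optimum.size≡ O) (Compression.size≡ C)
    ; shadows≤ = ≤-trans (Optimum.shadows≤ O) (Compression.shadows≤ C) }
    where
    C : Compression zero A
    C = compression opt optX zero A anti
    slices-or-better : ∀ D → D ⊆ hasZero → ∀ i →
                       (∀ t → IsInit (slice i hasZero t) (slice i D t)) ⊎ Improvement hasZero D
    slices-or-better D D⊆X i = ⊎-map (λ init → init)
      (λ lt → record { set = set ; inside = inside ; size≡ = size≡ ; shadows≤ = shadows≤ ; weight< = lt })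
      (weight< D⊆X)
      where open Compression (compression opt optX i D (hasZero-antichain {A = D} D⊆X))
    O : Optimum hasZero (Compression.set C)
    O = optimise hasZero-domain
      (λ D D⊆X → ⊎-map slices⇒compressed proj₂ (finite-choice (slices-or-better D D⊆X)))
      (Compression.set C) (Compression.inside C)

  antichain-optimum : ∀ n (A : PSet (suc r) n) → Antichain A → Optimum hasZero A
  antichain-optimum zero          = antichain-optimum₀
  antichain-optimum (suc zero)    = antichain-optimum₁
  antichain-optimum (suc (suc n)) = antichain-optimum-step (full-optimum (suc n)) (antichain-optimum (suc n))

  initial-segment-optimal : ∀ {n} {I A : PSet (suc r) n} → IsInit hasZero I → Antichain A → size I ≡ size A → shadows I ≤ shadows A
  initial-segment-optimal {n} {I} {A} init anti eq = ≤-trans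
    (shadows-mono {D = I} {set} (init-compare init isInit (≤-reflexive (trans eq (sym size≡))))) shadows≤
    where open Optimum (antichain-optimum n A anti)

-- Lists of integer points

open import Data.Integer as ℤ using (ℤ; +_; -[1+_]; ∣_∣; +≤+; +<+; -<+)
open import Data.Integer.Properties as ℤP using ()
open import Data.List using (List; []; _∷_; length; map; allFin; deduplicate; tabulate; filter)
open import Data.List.Membership.Propositional using (_∈_)
open import Data.List.Membership.Propositional.Properties using (∈-map⁺; ∈-map⁻; ∈-filter⁺; ∈-filter⁻; ∈-allFin; ∈-deduplicate⁺; ∈-deduplicate⁻)
open import Data.List.Properties using (map-tabulate)
open import Data.List.Relation.Unary.All as All using ()
open import Data.List.Relation.Unary.AllPairs using (_∷_)
open import Data.List.Relation.Unary.Any as LAny using (here; there)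
open import Data.List.Relation.Unary.Unique.DecPropositional.Properties using (deduplicate-!)
open import Data.List.Relation.Unary.Unique.Propositional using (Unique)
open import Data.Nat.ListAction renaming (sum to listSum) using ()
open import Data.Vec.Properties using (lookup-map)
open import Data.Vec.Relation.Unary.All as VAll using ()
open import Data.Vec.Relation.Unary.All.Properties using (lookup⁺; lookup⁻)
open import Data.Vec.Relation.Unary.Any as VAny using ()
open import Function.Bundles using (_⇔_; Equivalence)

_∈?_ : ∀ {n} (x : Pt n) A → Dec (x ∈ A)
x ∈? A = LAny.any? (x ≟ᵥ_) A

-- Instead of translating a list, it is read through an increasing `e`: the inclusion for S, and t ↦
-- t - K for A.
module Embedding {r : ℕ} (e : Fin (suc r) → ℤ) (e-mono : ∀ {s t} → s F.< t → e s ℤ.< e t) where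

  e-injective : ∀ {s t} → e s ≡ e t → s ≡ t
  e-injective {s} {t} eq with FP.<-cmp s t
  ... | tri< s<t _ _  = ⊥-elim (ℤP.<-irrefl eq (e-mono s<t))
  ... | tri≈ _ s≡t _  = s≡t
  ... | tri> _ _ t<s  = ⊥-elim (ℤP.<-irrefl (sym eq) (e-mono t<s))

  emb : ∀ {n} → Point (suc r) n → Pt n
  emb = vmap e

  emb-injective : ∀ {n} {u v : Point (suc r) n} → emb u ≡ emb v → u ≡ v
  emb-injective {u = []}    {[]}    _  = refl
  emb-injective {u = s ∷ u} {t ∷ v} eq =
    cong₂ _∷_ (e-injective (cong Data.Vec.head eq)) (emb-injective (cong Data.Vec.tail eq))

  Covered : ∀ {n} → List (Pt n) → Set
  Covered A = ∀ x → x ∈ A → ∃ λ u → emb u ≡ x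

  members : ∀ {n} → List (Pt n) → PSet (suc r) n
  members A u = does (emb u ∈? A)

  members-intro : ∀ {n} (A : List (Pt n)) u → emb u ∈ A → members A u ≡ true
  members-intro A u = dec-true (emb u ∈? A)

  members-elim : ∀ {n} (A : List (Pt n)) u → members A u ≡ true → emb u ∈ A
  members-elim A u = does-true (emb u ∈? A)

  length≡size : ∀ {n} (A : List (Pt n)) → Unique A → Covered A → length A ≡ size (members A)
  length≡size {n} []  _           _   = sym (size-empty {n = n} {D = members []} λ _ → refl)
  length≡size (x ∷ A) (x∉A ∷ uniq) cov with cov x (here refl)
  ... | v , refl = sym (trans (size-remove (members (x ∷ A)) v (members-intro (x ∷ A) v (here refl)))
                              (cong suc (trans (size-cong remove≗) (sym (length≡size A uniq λ y p → cov y (there p))))))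
    where
    forth : ∀ u → remove v (members (x ∷ A)) u ≡ true → members A u ≡ true
    forth u p with members-elim (x ∷ A) u (remove-⊆ v (members (x ∷ A)) u p)
    ... | there q = members-intro A u q
    ... | here q  = ⊥-elim (true≢false p (subst (λ u → remove v (members (x ∷ A)) u ≡ false) (sym (emb-injective q))
                                               (x∉remove v (members (x ∷ A)))))
    back : ∀ u → members A u ≡ true → remove v (members (x ∷ A)) u ≡ true
    back u p = ∈remove {D = members (x ∷ A)} (members-intro (x ∷ A) u (there (members-elim A u p)))
                       λ { refl → All.lookup x∉A (members-elim A u p) refl }
    remove≗ : ∀ u → remove v (members (x ∷ A)) u ≡ members A u
    remove≗ u = ⇔⇒≡ (forth u) (back u)

  card≡size : ∀ {n} (A : List (Pt n)) → Covered A → card A ≡ size (members A)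
  card≡size A cov = trans
    (length≡size (deduplicate _≟ᵥ_ A) (deduplicate-! _≟ᵥ_ A) λ x p → cov x (∈-deduplicate⁻ _≟ᵥ_ A p))
    (size-cong λ u → ⇔⇒≡
      (λ p → members-intro A u (∈-deduplicate⁻ _≟ᵥ_ A (members-elim (deduplicate _≟ᵥ_ A) u p)))
      (λ p → members-intro (deduplicate _≟ᵥ_ A) u (∈-deduplicate⁺ _≟ᵥ_ (members-elim A u p))))

  proj-emb : ∀ {n} i (u : Point (suc r) (suc n)) → proj i (emb u) ≡ emb (removeAt u i)
  proj-emb zero    (t ∷ u)     = refl
  proj-emb (suc i) (t ∷ s ∷ u) = cong (e t ∷_) (proj-emb i (s ∷ u))

  module _ {n} (A : List (Pt (suc n))) (cov : Covered A) where

    proj-covered : ∀ i → Covered (map (proj i) A)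
    proj-covered i x p with ∈-map⁻ (proj i) p
    ... | y , y∈A , refl with cov y y∈A
    ...   | u , refl = removeAt u i , sym (proj-emb i u)

    shadow≗proj : ∀ i u → members (map (proj i) A) u ≡ shadow i (members A) u
    shadow≗proj i u = ⇔⇒≡ forth back
      where
      forth : members (map (proj i) A) u ≡ true → shadow i (members A) u ≡ true
      forth p with ∈-map⁻ (proj i) (members-elim (map (proj i) A) u p)
      ... | y , y∈A , eq with cov y y∈A
      ...   | v , refl = subst (λ u → shadow i (members A) u ≡ true)
                (sym (emb-injective (trans eq (proj-emb i v)))) (shadow-introₚ i (members A) v (members-intro A v y∈A))
      back : shadow i (members A) u ≡ true → members (map (proj i) A) u ≡ true
      back p = let t , q = shadow-elim i (members A) u p in
        members-intro (map (proj i) A) u (subst (_∈ map (proj i) A)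
          (trans (proj-emb i (insertAt u i t)) (cong emb (removeAt-insertAt u i t)))
          (∈-map⁺ (proj i) (members-elim A (insertAt u i t) q)))

    card-proj : ∀ i → card (map (proj i) A) ≡ size (shadow i (members A))
    card-proj i = trans (card≡size (map (proj i) A) (proj-covered i)) (size-cong (shadow≗proj i))

    gap≡ : gap A ≡ + shadows (members A) ℤ.- + size (members A)
    gap≡ = cong₂ (λ a b → + a ℤ.- + b)
      (trans (cong listSum (map-tabulate (λ i → i) (λ i → card (map (proj i) A))))
             (trans (listSum-tabulate (λ i → card (map (proj i) A))) (sum-cong-≗ card-proj)))
      (card≡size A cov)
      where
      listSum-tabulate : ∀ {k} (f : Fin k → ℕ) → listSum (tabulate f) ≡ sum f
      listSum-tabulate {zero}  f = refl
      listSum-tabulate {suc k} f = cong (λ k → f zero + k) (listSum-tabulate (f ∘ suc))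

  members-antichain : ∀ {n} (A : List (Pt n)) → WeakAntichain A → Antichain (members A)
  members-antichain A anti x y p q x<y = anti (emb x) (emb y) (members-elim A x p) (members-elim A y q)
    λ i → subst₂ ℤ._<_ (sym (lookup-map i e x)) (sym (lookup-map i e y)) (e-mono (x<y i))

  cover-point : ∀ {n} (x : Pt n) → (∀ i → ∃ λ t → e t ≡ lookup x i) → ∃ λ u → emb u ≡ x
  cover-point []      h = [] , refl
  cover-point (a ∷ x) h = let t , p = h zero ; u , q = cover-point x (h ∘ suc) in t ∷ u , cong₂ _∷_ p q

nat : ∀ {m n} → Point m n → Pt n
nat = vmap λ t → + toℕ t

InX⇒hasZero : ∀ {r n} (u : Point (suc r) n) → InX (nat u) → hasZero u ≡ true
InX⇒hasZero u (_ , z) = go u z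
  where
  go : ∀ {r n} (u : Point (suc r) n) → VAny.Any (λ a → a ≡ + 0) (nat u) → hasZero u ≡ true
  go (zero ∷ u)  _              = refl
  go (suc t ∷ u) (VAny.there p) = go u p

nat-all : ∀ {m n} {P : ℤ → Set} (u : Point m n) → (∀ i → P (+ toℕ (lookup u i))) → VAll.All P (nat u)
nat-all {P = P} u p = lookup⁻ λ i → subst P (sym (lookup-map i (λ t → + toℕ t) u)) (p i)

nat-zero : ∀ {r n} (u : Point (suc r) n) → hasZero u ≡ true → VAny.Any (λ a → a ≡ + 0) (nat u)
nat-zero (zero ∷ u)  p = VAny.here refl
nat-zero (suc t ∷ u) p = VAny.there (nat-zero u p)

-- Agreement with the order of the statement

maxℤ-upper : ∀ {z} l → z ∈ l → z ℤ.≤ maxℤ l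
maxℤ-upper (a ∷ l) (here refl) = ℤP.i≤i⊔j a (maxℤ l)
maxℤ-upper (a ∷ l) (there p)   = ℤP.≤-trans (maxℤ-upper l p) (ℤP.i≤j⊔i a (maxℤ l))

maxℤ-lub : ∀ {s} l → -[1+ 0 ] ℤ.≤ s → (∀ z → z ∈ l → z ℤ.≤ s) → maxℤ l ℤ.≤ s
maxℤ-lub []      base h = base
maxℤ-lub (a ∷ l) base h = ℤP.⊔-lub (h a (here refl)) (maxℤ-lub l base λ z p → h z (there p))

maxℤ-< : ∀ {s} l → -[1+ 0 ] ℤ.< s → (∀ z → z ∈ l → z ℤ.< s) → maxℤ l ℤ.< s
maxℤ-< []      base h = base
maxℤ-< (a ∷ l) base h with ℤP.⊔-sel a (maxℤ l)
... | inj₁ eq = subst (ℤ._< _) (sym eq) (h a (here refl))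
... | inj₂ eq = subst (ℤ._< _) (sym eq) (maxℤ-< l base λ z p → h z (there p))

maxℕ-upper : ∀ {z} l → z ∈ l → z ≤ maxℕ l
maxℕ-upper (a ∷ l) (here refl) = m≤m⊔n a (maxℕ l)
maxℕ-upper (a ∷ l) (there p)   = ≤-trans (maxℕ-upper l p) (m≤n⊔m a (maxℕ l))

maxℕ-< : ∀ {s} l → 0 < s → (∀ z → z ∈ l → z < s) → maxℕ l < s
maxℕ-< []      base h = base
maxℕ-< (a ∷ l) base h = ⊔-lub (h a (here refl)) (maxℕ-< l base λ z p → h z (there p))

∈-diffIdx⁺ : ∀ {n} (x y : Pt n) i → lookup x i ≢ lookup y i → i ∈ diffIdx x y
∈-diffIdx⁺ x y i ne = ∈-filter⁺ (λ i → ¬? (lookup x i ℤ.≟ lookup y i)) (∈-allFin i) ne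

∈-diffIdx⁻ : ∀ {n} (x y : Pt n) i → i ∈ diffIdx x y → lookup x i ≢ lookup y i
∈-diffIdx⁻ {n} x y i p = proj₂ (∈-filter⁻ (λ i → ¬? (lookup x i ℤ.≟ lookup y i)) {xs = allFin n} p)

-- Over the coordinates where x and y differ, y attains its maximum s at j and x stays at or below
-- s. If x also attains s, it does so at indices less than j, since xⱼ < s.
≺⇒<B : ∀ {m n} {x y : Point m n} → x ≺ y → nat x <B nat y
≺⇒<B {m} {n} {x} {y} (j ▹ (xⱼ<yⱼ , d)) = cases (Mof (nat x) (nat y) ℤ.≟ + toℕ (lookup y j))
  where
  s : ℤ
  s = + toℕ (lookup y j)
  a b : Pt n
  a = nat x
  b = nat y
  a≡ : ∀ i → lookup a i ≡ + toℕ (lookup x i)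
  a≡ i = lookup-map i (λ t → + toℕ t) x
  b≡ : ∀ i → lookup b i ≡ + toℕ (lookup y i)
  b≡ i = lookup-map i (λ t → + toℕ t) y
  rank : ∀ i → lookup a i ≢ lookup b i → (lookup x i , i) ⊑ (lookup y j , j) × (lookup y i , i) ⊑ (lookup y j , j)
  rank i ne with d i
  ... | inj₂ p = p
  ... | inj₁ e = ⊥-elim (ne (trans (a≡ i) (trans (cong (λ t → + toℕ t) e) (sym (b≡ i)))))
  aⱼ≢bⱼ : lookup a j ≢ lookup b j
  aⱼ≢bⱼ eq = <-irrefl (ℤP.+-injective (trans (sym (a≡ j)) (trans eq (b≡ j)))) xⱼ<yⱼ
  Mxy≤s : Mof a b ℤ.≤ s
  Mxy≤s = maxℤ-lub _ ℤ.-≤+ bound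
    where
    bound : ∀ z → z ∈ map (lookup a) (diffIdx a b) → z ℤ.≤ s
    bound z p with ∈-map⁻ (lookup a) p
    ... | i , i∈ , refl rewrite a≡ i = +≤+ (⊑⇒≤ (proj₁ (rank i (∈-diffIdx⁻ a b i i∈))))
  Myx≡s : Mof b a ≡ s
  Myx≡s = ℤP.≤-antisym (maxℤ-lub _ ℤ.-≤+ bound)
    (subst (ℤ._≤ Mof b a) (b≡ j) (maxℤ-upper _ (∈-map⁺ (lookup b) (∈-diffIdx⁺ b a j (aⱼ≢bⱼ ∘ sym)))))
    where
    bound : ∀ z → z ∈ map (lookup b) (diffIdx b a) → z ℤ.≤ s
    bound z p with ∈-map⁻ (lookup b) p
    ... | i , i∈ , refl rewrite b≡ i = +≤+ (⊑⇒≤ (proj₂ (rank i (∈-diffIdx⁻ b a i i∈ ∘ sym))))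
  index : ∀ i → i ∈ diffIdx a b → lookup a i ℤ.< s ⊎ toℕ i < toℕ j
  index i i∈ with rank i (∈-diffIdx⁻ a b i i∈)
  ... | inj₁ lt , _        = inj₁ (subst (ℤ._< s) (sym (a≡ i)) (+<+ lt))
  ... | inj₂ (eq , i≤j) , _ = inj₂ (≤∧≢⇒< i≤j λ i≡j →
          <-irrefl (cong toℕ (trans (cong (lookup x) (sym (FP.toℕ-injective i≡j))) eq)) xⱼ<yⱼ)
  maximal : Mof a b ≡ s → ∀ i → i ∈ filter (λ i → lookup a i ℤ.≟ Mof a b) (diffIdx a b) → toℕ i < toℕ j
  maximal eq i p with ∈-filter⁻ (λ i → lookup a i ℤ.≟ Mof a b) {xs = diffIdx a b} p
  ... | i∈ , aᵢ≡M with index i i∈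
  ...   | inj₁ lt = ⊥-elim (ℤP.<-irrefl (trans aᵢ≡M eq) lt)
  ...   | inj₂ lt = lt
  -- `maxℕ` starts from 0, so a maximum below j requires j > 0. With j = 0 all differing values of x
  -- would be below s, contrary to the hypothesis.
  0<j : Mof a b ≡ s → 0 < toℕ j
  0<j eq = n≢0⇒n>0 λ j≡0 → ℤP.<-irrefl eq (maxℤ-< _ -<+ (bound j≡0))
    where
    bound : toℕ j ≡ 0 → ∀ z → z ∈ map (lookup a) (diffIdx a b) → z ℤ.< s
    bound j≡0 z p with ∈-map⁻ (lookup a) p
    ... | i , i∈ , refl with index i i∈
    ...   | inj₁ lt = lt
    ...   | inj₂ lt = ⊥-elim (n≮0 (subst (toℕ i <_) j≡0 lt))
  Ixy<j : Mof a b ≡ s → Iof a b < toℕ j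
  Ixy<j eq = maxℕ-< _ (0<j eq) bound
    where
    bound : ∀ z → z ∈ map toℕ (filter (λ i → lookup a i ℤ.≟ Mof a b) (diffIdx a b)) → z < toℕ j
    bound z p with ∈-map⁻ toℕ p
    ... | i , i∈ , refl = maximal eq i i∈
  j≤Iyx : toℕ j ≤ Iof b a
  j≤Iyx = maxℕ-upper _ (∈-map⁺ toℕ (∈-filter⁺ (λ i → lookup b i ℤ.≟ Mof b a) (∈-diffIdx⁺ b a j (aⱼ≢bⱼ ∘ sym))
                                              (trans (b≡ j) (sym Myx≡s))))
  cases : Dec (Mof a b ≡ s) → a <B b
  cases (no ne)  = inj₁ (subst (Mof a b ℤ.<_) (sym Myx≡s) (ℤP.≤∧≢⇒< Mxy≤s ne))
  cases (yes eq) = inj₂ (trans eq (sym Myx≡s) , <-≤-trans (Ixy<j eq) j≤Iyx)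

-- From boxes to lists of integer points

bounded : ∀ {n} (A : List (Pt n)) → ∃ λ K → ∀ x → x ∈ A → ∀ i → ∣ lookup x i ∣ ≤ K
bounded []      = 0 , λ _ ()
bounded (x ∷ A) = let K , h = bounded A in norm x ⊔ K , λ
  { y (here refl) i → ≤-trans (norm-upper x i) (m≤m⊔n (norm x) K)
  ; y (there p)   i → ≤-trans (h y p i) (m≤n⊔m (norm x) K) }
  where
  norm : ∀ {n} → Pt n → ℕ
  norm []      = 0
  norm (a ∷ x) = ∣ a ∣ ⊔ norm x
  norm-upper : ∀ {n} (x : Pt n) i → ∣ lookup x i ∣ ≤ norm x
  norm-upper (a ∷ x) zero    = m≤m⊔n ∣ a ∣ (norm x)
  norm-upper (a ∷ x) (suc i) = ≤-trans (norm-upper x i) (m≤n⊔m ∣ a ∣ (norm x))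

-- Required for every r because the box is chosen later, from both lists. Initial segments and A_N
-- enter the main argument through this common form.
DownClosed : ∀ {n} → List (Pt n) → Set
DownClosed {n} S = ∀ {r} (v u : Point (suc r) n) → hasZero v ≡ true → v ≺ u → nat u ∈ S → nat v ∈ S

segment-optimal : ∀ {n} (S A : List (Pt (suc n))) → Unique S → Unique A → (∀ x → x ∈ S → InX x) → DownClosed S →
                  WeakAntichain A → length S ≡ length A → gap S ℤ.≤ gap A
segment-optimal {n} S A uniqS uniqA S⊆X closedS anti eq = begin
  gap S
    ≡⟨ S′.gap≡ S coverS ⟩
  + shadows (S′.members S) ℤ.- + size (S′.members S)
    ≡⟨ cong (λ k → + shadows (S′.members S) ℤ.- + k) sizes ⟩
  + shadows (S′.members S) ℤ.- + size (A′.members A)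
    ≤⟨ ℤP.+-monoˡ-≤ (ℤ.- + size (A′.members A)) (+≤+ (initial-segment-optimal initS (A′.members-antichain A anti) sizes)) ⟩
  + shadows (A′.members A) ℤ.- + size (A′.members A)
    ≡⟨ sym (A′.gap≡ A coverA) ⟩
  gap A ∎
  where
  open ℤP.≤-Reasoning
  K r : ℕ
  K = proj₁ (bounded A) ⊔ proj₁ (bounded S)
  -- Shifted by K, the coordinates of A lie between 0 and 2K.
  r = K + K
  boundA : ∀ x → x ∈ A → ∀ i → ∣ lookup x i ∣ ≤ K
  boundA x p i = ≤-trans (proj₂ (bounded A) x p i) (m≤m⊔n _ _)
  boundS : ∀ x → x ∈ S → ∀ i → ∣ lookup x i ∣ ≤ K
  boundS x p i = ≤-trans (proj₂ (bounded S) x p i) (m≤n⊔m (proj₁ (bounded A)) _)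
  eS eA : Fin (suc r) → ℤ
  eS t = + toℕ t
  eA t = + toℕ t ℤ.- + K
  module S′ = Embedding eS (λ s<t → +<+ s<t)
  module A′ = Embedding eA (λ s<t → ℤP.+-monoˡ-< (ℤ.- + K) (+<+ s<t))
  value : ∀ {k} → k ≤ r → ∃ λ (t : Fin (suc r)) → toℕ t ≡ k
  value k≤r = F.fromℕ< (s≤s k≤r) , FP.toℕ-fromℕ< (s≤s k≤r)
  shift : ∀ a → ∣ a ∣ ≤ K → ∃ λ k → k ≤ r × + k ≡ a ℤ.+ + K
  shift (+ k)    le = k + K , +-monoˡ-≤ K le , refl
  shift -[1+ k ] le = K ∸ suc k , ≤-trans (m∸n≤m K (suc k)) (m≤m+n K K) , sym (ℤP.⊖-≥ le)
  coverA : A′.Covered A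
  coverA x p = A′.cover-point x coordinate
    where
    coordinate : ∀ i → ∃ λ t → eA t ≡ lookup x i
    coordinate i = let k , k≤r , q = shift (lookup x i) (boundA x p i) ; t , t≡k = value k≤r in t , (begin-equality
      + toℕ t ℤ.- + K                          ≡⟨ cong (λ k → + k ℤ.- + K) t≡k ⟩
      + k ℤ.- + K                              ≡⟨ cong (λ a → a ℤ.- + K) q ⟩
      (lookup x i ℤ.+ + K) ℤ.- + K             ≡⟨ ℤP.+-assoc (lookup x i) (+ K) (ℤ.- + K) ⟩
      lookup x i ℤ.+ (+ K ℤ.- + K)             ≡⟨ cong (λ a → lookup x i ℤ.+ a) (ℤP.+-inverseʳ (+ K)) ⟩
      lookup x i ℤ.+ + 0                       ≡⟨ ℤP.+-identityʳ (lookup x i) ⟩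
      lookup x i                               ∎)
  coverS : S′.Covered S
  coverS x p = S′.cover-point x λ i → let t , t≡ = value (≤-trans (boundS x p i) (m≤m+n K K)) in
    t , trans (cong +_ t≡) (ℤP.0≤i⇒+∣i∣≡i (lookup⁺ (proj₁ (S⊆X x p)) i))
  sizes : size (S′.members S) ≡ size (A′.members A)
  sizes = trans (sym (S′.length≡size S uniqS coverS)) (trans eq (A′.length≡size A uniqA coverA))
  initS : IsInit hasZero (S′.members S)
  initS = record
    { sub = λ u p → InX⇒hasZero u (S⊆X (nat u) (S′.members-elim S u p))
    ; closed = λ v u v∈X v≺u p → S′.members-intro S v (closedS v u v∈X v≺u (S′.members-elim S u p)) }

-- The set A_N

size-full : ∀ m n → size {m} {n} full ≡ m ^ n
size-full m zero    = refl
size-full m (suc n) = trans (sum-cong-≗ {m} λ _ → size-full m n) (sum-const m (m ^ n))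

-- Split by the first coordinate: 0 leaves the others free, and each of the r positive values asks
-- for a zero among them.
size-hasZero : ∀ r n → size {suc r} {n} hasZero + r ^ n ≡ suc r ^ n
size-hasZero r zero    = refl
size-hasZero r (suc n) = begin
  size {suc r} {n} full + sum {r} (λ _ → h) + r * r ^ n
    ≡⟨ cong₂ (λ a b → a + b + r * r ^ n) (size-full (suc r) n) (sum-const r h) ⟩
  suc r ^ n + r * h + r * r ^ n
    ≡⟨ trans (+-assoc (suc r ^ n) (r * h) (r * r ^ n)) (cong (λ k → suc r ^ n + k) (sym (*-distribˡ-+ r h (r ^ n)))) ⟩
  suc r ^ n + r * (h + r ^ n)
    ≡⟨ cong (λ k → suc r ^ n + r * k) (size-hasZero r n) ⟩
  suc r ^ n + r * suc r ^ n ∎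
  where
  open ≡-Reasoning
  h = size {suc r} {n} hasZero

length-AN : ∀ {n} N → 1 ≤ N → (S : List (Pt n)) → Unique S → (∀ x → (x ∈ S) ⇔ InAN N x) → length S ≡ N ^ n ∸ (N ∸ 1) ^ n
length-AN {n} (suc r) _ S uniq S≡ = begin
  length S                              ≡⟨ S′.length≡size S uniq cover ⟩
  size (S′.members S)                   ≡⟨ size-cong (λ u → ⇔⇒≡ (forth u) (back u)) ⟩
  size {suc r} {n} hasZero              ≡⟨ sym (m+n∸n≡m _ (r ^ n)) ⟩
  size {suc r} {n} hasZero + r ^ n ∸ r ^ n ≡⟨ cong (_∸ r ^ n) (size-hasZero r n) ⟩
  suc r ^ n ∸ r ^ n                     ∎
  where
  open ≡-Reasoning
  module S′ = Embedding {r} (λ t → + toℕ t) (λ s<t → +<+ s<t)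
  cover : S′.Covered S
  cover x p = S′.cover-point x λ i → coordinate (lookup⁺ (proj₁ (Equivalence.to (S≡ x) p)) i)
    where
    coordinate : ∀ {a} → (+ 0 ℤ.≤ a) × (a ℤ.< + suc r) → ∃ λ (t : Fin (suc r)) → + toℕ t ≡ a
    coordinate (+≤+ _ , +<+ a<) = F.fromℕ< a< , cong +_ (FP.toℕ-fromℕ< a<)
  forth : ∀ u → S′.members S u ≡ true → hasZero u ≡ true
  forth u p = InX⇒hasZero u (VAll.map proj₁ (proj₁ q) , proj₂ q)
    where q = Equivalence.to (S≡ (nat u)) (S′.members-elim S u p)
  back : ∀ u → hasZero u ≡ true → S′.members S u ≡ true
  back u p = S′.members-intro S u (Equivalence.from (S≡ (nat u)) (nat-all u (λ i → +≤+ z≤n , +<+ (FP.toℕ<n (lookup u i))) , nat-zero u p))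

-- Each coordinate of a smaller v either equals that of u or is at most the deciding value of u,
-- which is below N.
AN-downClosed : ∀ {n} N (S : List (Pt n)) → (∀ x → (x ∈ S) ⇔ InAN N x) → DownClosed S
AN-downClosed {n} N S S≡ v u v∈X (j ▹ (vⱼ<uⱼ , d)) u∈S =
  Equivalence.from (S≡ (nat v)) (nat-all v (λ i → +≤+ z≤n , +<+ (small i)) , nat-zero v v∈X)
  where
  u<N : ∀ i → toℕ (lookup u i) < N
  u<N i = ℤP.drop‿+<+ (subst (ℤ._< + N) (lookup-map i (λ t → + toℕ t) u)
                            (proj₂ (lookup⁺ (proj₁ (Equivalence.to (S≡ (nat u)) u∈S)) i)))
  small : ∀ i → toℕ (lookup v i) < N
  small i with d i
  ... | inj₁ e       = subst (λ t → toℕ t < N) (sym e) (u<N i)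
  ... | inj₂ (p , _) = ≤-<-trans (⊑⇒≤ p) (u<N j)

theorem3 : (n : ℕ) → 2 ≤ n →
    ((m : ℕ) (S : List (Pt n)) → IsInitialSegment S m →
    (A : List (Pt n)) → Unique A → WeakAntichain A → length A ≡ m →
    gap S ℤ.≤ gap A)
    ×
    ((N : ℕ) → 1 ≤ N → (S : List (Pt n)) → Unique S → (∀ x → (x ∈ S) ⇔ InAN N x) →
    (A : List (Pt n)) → Unique A → WeakAntichain A → length A ≡ N ^ n ∸ (N ∸ 1) ^ n →
    gap S ℤ.≤ gap A)
theorem3 (suc n) _ =
  (λ m S (uniqS , |S|≡m , S⊆X , closed) A uniqA anti |A|≡m →
    segment-optimal S A uniqS uniqA S⊆X
      (λ v u v∈X v≺u u∈S → closed (nat u) (nat v) u∈S (nat-all v (λ _ → +≤+ z≤n) , nat-zero v v∈X) (≺⇒<B v≺u))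
      anti (trans |S|≡m (sym |A|≡m)))
  , λ N 1≤N S uniqS S≡ A uniqA anti |A|≡ →
    segment-optimal S A uniqS uniqA
      (λ x p → let q = Equivalence.to (S≡ x) p in VAll.map proj₁ (proj₁ q) , proj₂ q)
      (AN-downClosed N S S≡) anti (trans (length-AN N 1≤N S uniqS S≡) (sym |A|≡))
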